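{- There is an absolute constant $C>0$ such that for all positive integers $n\le m$ (with $m$ sufficiently large), \[ s(m,n,3)\le C\sqrt{mn\lg\frac{2m}{n}}. \]
   Context: $\lg$ denotes logarithm to base $2$. Let $[m]=\{1,\dots,m\}$. An $(m,n,s)$-storing scheme is a map $\phi$ from the family of subsets of $[m]$ of size at most $n$ to $\{0,1\}^s$. An $(m,s,t)$-query scheme is a family $\{T_u\}_{u\in[m]}$ of Boolean decision trees of depth at most $t$: each internal node is marked with an index in $\{1,\dots,s\}$, has outgoing edges labelled $0$ and $1$, and each leaf is marked Yes or No; $T_u$ maps $\{0,1\}^s$ to $\{\mathrm{Yes},\mathrm{No}\}$ by following the edges given by the probed bits (probes may be adaptive). An $(m,n,s,t)$-scheme is a pair $(\phi,\{T_u\})$ such that for every $S\subseteq[m]$ with $|S|\le n$ and every $u\in[m]$, $T_u(\phi(S))=\mathrm{Yes}$ iff $u\in S$. $s(m,n,t)$ is the minimum $s$ for which an $(m,n,s,t)$-scheme exists. -}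

module Defs where

open import Data.Nat using (ℕ; zero; suc; _+_; _*_; _^_; _≤_; _⊔_)
open import Data.Bool using (Bool; true; false; if_then_else_)
open import Data.Fin using (Fin)
open import Data.Fin.Subset using (Subset; _∈_; ∣_∣)
open import Data.Vec using (Vec; lookup)
open import Data.Product using (Σ; _×_; _,_)
open import Relation.Binary.PropositionalEquality using (_≡_)

data DTree (s : ℕ) : Set where
  leaf : Bool → DTree s
  node : Fin s → (on0 : DTree s) → (on1 : DTree s) → DTree s

depth : ∀ {s} → DTree s → ℕ
depth (leaf _)     = 0
depth (node _ l r) = suc (depth l ⊔ depth r)

eval : ∀ {s} → DTree s → Vec Bool s → Bool
eval (leaf b)     w = b
eval (node i l r) w = if lookup w i then eval r w else eval l w

StoringScheme : ℕ → ℕ → ℕ → Set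
StoringScheme m n s = (S : Subset m) → ∣ S ∣ ≤ n → Vec Bool s

QueryScheme : ℕ → ℕ → ℕ → Set
QueryScheme m s t = Σ (Fin m → DTree s) λ T → (u : Fin m) → depth (T u) ≤ t

Scheme : ℕ → ℕ → ℕ → ℕ → Set
Scheme m n s t =
  Σ (StoringScheme m n s) λ φ →
  Σ (QueryScheme m s t) λ Q →
    (S : Subset m) (hS : ∣ S ∣ ≤ n) (u : Fin m) →
      (eval (Σ.proj₁ Q u) (φ S hS) ≡ true → u ∈ S) ×
      (u ∈ S → eval (Σ.proj₁ Q u) (φ S hS) ≡ true)

{-# OPTIONS --safe #-}
-- Every element u is given six cells out of q, one for each node of a query that probes two bits A and B,
-- which select one of four leaves, whose bit is the answer. In a random such assignment any k ≤ k₀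
-- elements see at least 4k cells, and k₀ elements see more than 4k₀ + 2n + 1; here k₀ is about
-- n lg(2m/n) and q about √(m k₀). Given S, take a largest R ⊇ S with |R| ≤ k₀ that sees at most 4|R| + 2n
-- cells. By Hall's theorem every element of R can own four of its cells; four controlled nodes out of six
-- suffice to force the answer. By maximality an element outside R shares at most one cell with R, and it
-- matters only if that cell is a leaf: then the element has to steer away from it, for which it suffices to
-- own its cell for A or B. Maximality again yields Hall's condition for these elements and cells: each
-- adds three leaves, so k of them that see only about k fresh A- and B-cells could be added to R.
module Submission where

open import Defs
open import Data.Bool using (Bool; true; false; if_then_else_; not)
open import Data.Bool.Properties using (not-¬) renaming (_≟_ to _≟ᵇ_)
open import Data.Fin using (Fin; zero; suc; combine; remQuot)
open import Data.Fin.Properties using (any?; remQuot-combine) renaming (_≟_ to _≟ᶠ_; suc-injective to suc-injectiveᶠ)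
open import Data.Fin.Subset
open import Data.Fin.Subset.Properties
open import Data.List using (List; []; _∷_; _++_; cartesianProductWith; allFin) renaming (map to mapᴸ; tabulate to tabulateᴸ)
open import Data.List.Membership.Propositional using () renaming (_∈_ to _∈ᴸ_)
open import Data.List.Membership.Propositional.Properties using (∈-cartesianProductWith⁺)
open import Data.List.Relation.Unary.Any using () renaming (here to hereᴸ; there to thereᴸ)
open import Data.Nat using (ℕ; zero; suc; _+_; _*_; _∸_; _^_; _⊓_; _≤_; _<_; z≤n; s≤s; s≤s⁻¹; _≟_; _≤?_; _<?_; ⌊_/2⌋; ⌈_/2⌉; NonZero; >-nonZero; >-nonZero⁻¹; ≢-nonZero)
open import Data.Nat.Induction using (<-wellFounded)
open import Data.Nat.Properties hiding (_≟_; _≤?_; _<?_; suc-injective)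
open import Data.Nat.Tactic.RingSolver using (solve-∀)
open import Data.Product using (Σ; ∃; ∃₂; _×_; _,_; proj₁; proj₂)
open import Data.Sum using (_⊎_; inj₁; inj₂; [_,_]′)
open import Data.Vec using (Vec; []; _∷_; lookup; tabulate; here; there; map; replicate)
open import Data.Vec.Properties using (lookup∘tabulate; lookup⇒[]=; []=⇒lookup; lookup-map; lookup-replicate)
open import Function using (_∘_; const; case_of_)
open import Induction.WellFounded using (Acc; acc)
open import Relation.Binary.PropositionalEquality
open import Relation.Nullary using (Dec; yes; no; ¬_; does; contradiction)
open import Relation.Nullary.Decidable using (_×-dec_; _→-dec_; ¬?; dec-true; dec-false; decidable-stable; map′; from-no)
open import Relation.Unary using (Decidable)

-- The union bound dictates the sizes. A set R of k elements and a set V of v = 4k + e cells can be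
-- chosen in about (m/k)^k (q/v)^v ways, up to constant factors per element, and R sees only V with
-- probability (v/q)^(6k). As v is of order k, the product is about (mk/q²)^k (q/k)^e. For e = 0 it
-- is small for all k ≤ k₀ once q² is a large multiple of m k₀: the surplus of six cells over four
-- is the exponent 2 of q, hence the square root. Slack e costs (q/k)^e, to be absorbed by 2^k; with
-- e of order n this needs k of order n lg(q/k), and that is the origin of k₀. The slack 2n is
-- forced by S, whose elements may see six cells each instead of four. An element outside R can err
-- only at a leaf shared with R because every leaf cell not seen by R holds 0.

private variable
  A B : Set
  m n q : ℕ


-- Finite subsets: comprehension, weights, cardinalities, neighbourhoods

⟪_⟫ : {P : Fin m → Set} → Decidable P → Subset m
⟪ P? ⟫ = tabulate (does ∘ P?)

module _ {P : Fin m → Set} (P? : Decidable P) where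

  ∈⟪⟫⁺ : ∀ {x} → P x → x ∈ ⟪ P? ⟫
  ∈⟪⟫⁺ {x} px =
    lookup⇒[]= x _ (trans (lookup∘tabulate (does ∘ P?) x) (dec-true (P? x) px))

  ∈⟪⟫⁻ : ∀ {x} → x ∈ ⟪ P? ⟫ → P x
  ∈⟪⟫⁻ {x} x∈ with P? x | trans (sym (lookup∘tabulate (does ∘ P?) x)) ([]=⇒lookup x∈)
  ... | yes px | _ = px

bit : Bool → ℕ
bit true  = 1
bit false = 0

weight : (Fin m → ℕ) → Subset m → ℕ
weight d []          = 0
weight d (true  ∷ X) = d zero + weight (d ∘ suc) X
weight d (false ∷ X) = weight (d ∘ suc) X

weight-∪-∩ : (d : Fin m → ℕ) (X Z : Subset m) →
  weight d (X ∪ Z) + weight d (X ∩ Z) ≡ weight d X + weight d Z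
weight-∪-∩ d [] [] = refl
weight-∪-∩ d (x ∷ X) (z ∷ Z) with weight-∪-∩ (d ∘ suc) X Z
weight-∪-∩ d (true  ∷ X) (true  ∷ Z) | ih =
  trans (lemma (d zero) _ _) (trans (cong (d zero + d zero +_) ih) (sym (lemma (d zero) _ _)))
  where
  lemma : ∀ a b c → (a + b) + (a + c) ≡ (a + a) + (b + c)
  lemma = solve-∀
weight-∪-∩ d (true  ∷ X) (false ∷ Z) | ih =
  trans (+-assoc (d zero) _ _) (trans (cong (d zero +_) ih) (sym (+-assoc (d zero) _ _)))
weight-∪-∩ d (false ∷ X) (true  ∷ Z) | ih =
  trans (+-assoc (d zero) _ _) (trans (cong (d zero +_) ih) (lemma (d zero) (weight (d ∘ suc) X) _))
  where
  lemma : ∀ a b c → a + (b + c) ≡ b + (a + c)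
  lemma = solve-∀
weight-∪-∩ d (false ∷ X) (false ∷ Z) | ih = ih

weight-1 : (X : Subset m) → weight (const 1) X ≡ ∣ X ∣
weight-1 []          = refl
weight-1 (true  ∷ X) = cong suc (weight-1 X)
weight-1 (false ∷ X) = weight-1 X

weight-⁅⁆ : (d : Fin m → ℕ) (i : Fin m) → weight d ⁅ i ⁆ ≡ d i
weight-⁅⁆ d zero    = trans (cong (d zero +_) (weight-⊥ (d ∘ suc))) (+-identityʳ _)
  where
  weight-⊥ : ∀ {m} (d : Fin m → ℕ) → weight d ⊥ ≡ 0
  weight-⊥ {zero}  d = refl
  weight-⊥ {suc m} d = weight-⊥ (d ∘ suc)
weight-⁅⁆ d (suc i) = weight-⁅⁆ (d ∘ suc) i

weight-mono : {d e : Fin m → ℕ} (X : Subset m) → (∀ {i} → i ∈ X → d i ≤ e i) →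
  weight d X ≤ weight e X
weight-mono []          d≤e = z≤n
weight-mono (true  ∷ X) d≤e = +-mono-≤ (d≤e here) (weight-mono X (d≤e ∘ there))
weight-mono (false ∷ X) d≤e = weight-mono X (d≤e ∘ there)

weight-⊤-strict : {d e : Fin m → ℕ} (i : Fin m) → d i < e i → (∀ j → d j ≤ e j) →
  weight d ⊤ < weight e ⊤
weight-⊤-strict zero    d<e d≤e = +-mono-<-≤ d<e (weight-mono ⊤ (λ {j} _ → d≤e (suc j)))
weight-⊤-strict (suc i) d<e d≤e = +-mono-≤-< (d≤e zero) (weight-⊤-strict i d<e (d≤e ∘ suc))

weight-const : ∀ c (X : Subset m) → weight (const c) X ≡ c * ∣ X ∣
weight-const c []          = sym (*-zeroʳ c)
weight-const c (true  ∷ X) = trans (cong (c +_) (weight-const c X)) (sym (*-suc c ∣ X ∣))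
weight-const c (false ∷ X) = weight-const c X

∣∪∣+∣∩∣ : (X Z : Subset m) → ∣ X ∪ Z ∣ + ∣ X ∩ Z ∣ ≡ ∣ X ∣ + ∣ Z ∣
∣∪∣+∣∩∣ X Z = begin
  ∣ X ∪ Z ∣ + ∣ X ∩ Z ∣
    ≡⟨ cong₂ _+_ (weight-1 (X ∪ Z)) (weight-1 (X ∩ Z)) ⟨
  weight (const 1) (X ∪ Z) + weight (const 1) (X ∩ Z)
    ≡⟨ weight-∪-∩ (const 1) X Z ⟩
  weight (const 1) X + weight (const 1) Z
    ≡⟨ cong₂ _+_ (weight-1 X) (weight-1 Z) ⟩
  ∣ X ∣ + ∣ Z ∣ ∎
  where open ≡-Reasoning

∣∪∣≤ : (X Z : Subset m) → ∣ X ∪ Z ∣ ≤ ∣ X ∣ + ∣ Z ∣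
∣∪∣≤ X Z = subst (∣ X ∪ Z ∣ ≤_) (∣∪∣+∣∩∣ X Z) (m≤m+n _ _)

Disjoint : Subset m → Subset m → Set
Disjoint X Z = ∀ {x} → x ∈ X → x ∉ Z

Empty⇒∣∣≡0 : {X : Subset m} → Empty X → ∣ X ∣ ≡ 0
Empty⇒∣∣≡0 {m} ∅ = trans (cong ∣_∣ (Empty-unique ∅)) (∣⊥∣≡0 m)

∣∪∣-disjoint : (X Z : Subset m) → Disjoint X Z → ∣ X ∪ Z ∣ ≡ ∣ X ∣ + ∣ Z ∣
∣∪∣-disjoint X Z X#Z = begin
  ∣ X ∪ Z ∣              ≡⟨ +-identityʳ _ ⟨
  ∣ X ∪ Z ∣ + 0          ≡⟨ cong (∣ X ∪ Z ∣ +_) (Empty⇒∣∣≡0 ∅) ⟨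
  ∣ X ∪ Z ∣ + ∣ X ∩ Z ∣  ≡⟨ ∣∪∣+∣∩∣ X Z ⟩
  ∣ X ∣ + ∣ Z ∣          ∎
  where
  open ≡-Reasoning
  ∅ : Empty (X ∩ Z)
  ∅ (x , x∈) = let x∈X , x∈Z = x∈p∩q⁻ X Z x∈ in X#Z x∈X x∈Z

x∈p─q⁻ : ∀ {x} (p q : Subset m) → x ∈ p ─ q → x ∈ p × x ∉ q
x∈p─q⁻ (true ∷ p) (false ∷ q) here = here , λ ()
x∈p─q⁻ (_ ∷ p) (true  ∷ q) (there x∈) =
  let a , b = x∈p─q⁻ p q x∈ in there a , λ { (there c) → b c }
x∈p─q⁻ (_ ∷ p) (false ∷ q) (there x∈) =
  let a , b = x∈p─q⁻ p q x∈ in there a , λ { (there c) → b c }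

∣-∣ : (p : Subset m) (x : Fin m) → ∣ p ∣ ≤ suc ∣ p - x ∣
∣-∣ p x = begin
  ∣ p ∣                  ≤⟨ p⊆q⇒∣p∣≤∣q∣ sub ⟩
  ∣ ⁅ x ⁆ ∪ (p - x) ∣    ≤⟨ ∣∪∣≤ ⁅ x ⁆ (p - x) ⟩
  ∣ ⁅ x ⁆ ∣ + ∣ p - x ∣  ≡⟨ cong (_+ ∣ p - x ∣) (∣⁅x⁆∣≡1 x) ⟩
  suc ∣ p - x ∣          ∎
  where
  open ≤-Reasoning
  sub : p ⊆ ⁅ x ⁆ ∪ (p - x)
  sub {y} y∈p with y ≟ᶠ x
  ... | yes refl = x∈p∪q⁺ (inj₁ (x∈⁅x⁆ x))
  ... | no  y≢x  = x∈p∪q⁺ (inj₂ (x∈p∧x≢y⇒x∈p-y y∈p y≢x))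

abstract

  nbr : (Fin m → Subset q) → Subset m → Subset q
  nbr N X = ⟪ (λ c → any? (λ i → i ∈? X ×-dec c ∈? N i)) ⟫

  ∈nbr⁺ : {N : Fin m → Subset q} {X : Subset m} → ∀ {c i} → i ∈ X → c ∈ N i → c ∈ nbr N X
  ∈nbr⁺ {N = N} {X} {i = i} i∈X c∈Ni = 
    ∈⟪⟫⁺ (λ c → any? (λ i → i ∈? X ×-dec c ∈? N i)) (i , i∈X , c∈Ni)

  ∈nbr⁻ : {N : Fin m → Subset q} {X : Subset m} → ∀ {c} →
    c ∈ nbr N X → ∃ λ i → i ∈ X × c ∈ N i
  ∈nbr⁻ {N = N} {X} = ∈⟪⟫⁻ (λ c → any? (λ i → i ∈? X ×-dec c ∈? N i))

nbr-mono : {N : Fin m → Subset q} {X Z : Subset m} → X ⊆ Z → nbr N X ⊆ nbr N Z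
nbr-mono X⊆Z c∈ = let i , i∈X , c∈Ni = ∈nbr⁻ c∈ in ∈nbr⁺ (X⊆Z i∈X) c∈Ni

nbr-⁅⁆ : (N : Fin m → Subset q) (u : Fin m) → nbr N ⁅ u ⁆ ⊆ N u
nbr-⁅⁆ N u c∈ = let v , v∈ , c∈N = ∈nbr⁻ c∈ in subst (λ w → _ ∈ N w) (x∈⁅y⁆⇒x≡y u v∈) c∈N

nbr-∪ : (N : Fin m → Subset q) (X Z : Subset m) → nbr N (X ∪ Z) ⊆ nbr N X ∪ nbr N Z
nbr-∪ N X Z c∈ = let i , i∈ , c∈Ni = ∈nbr⁻ c∈ in
  x∈p∪q⁺ ([ (λ i∈X → inj₁ (∈nbr⁺ i∈X c∈Ni)) , (λ i∈Z → inj₂ (∈nbr⁺ i∈Z c∈Ni)) ]′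
    (x∈p∪q⁻ X Z i∈))

nbr-suc : (N : Fin (suc m) → Subset q) (b : Bool) (X : Subset m) →
  nbr N (b ∷ X) ⊆ (if b then N zero else ⊥) ∪ nbr (N ∘ suc) X
nbr-suc N b X c∈ with ∈nbr⁻ {N = N} {X = b ∷ X} c∈
nbr-suc N true X c∈ | zero , here , c∈N = x∈p∪q⁺ (inj₁ c∈N)
... | suc i , there i∈X , c∈N = x∈p∪q⁺ (inj₂ (∈nbr⁺ i∈X c∈N))

∣nbr∣≤weight : (N : Fin m → Subset q) (X : Subset m) → ∣ nbr N X ∣ ≤ weight (∣_∣ ∘ N) X
∣nbr∣≤weight N []      = ≤-reflexive (Empty⇒∣∣≡0 λ { (c , c∈) → case ∈nbr⁻ c∈ of λ { (_ , () , _) } })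
∣nbr∣≤weight {q = q} N (b ∷ X) = ≤-trans (p⊆q⇒∣p∣≤∣q∣ (nbr-suc N b X))
  (≤-trans (∣∪∣≤ (if b then N zero else ⊥) (nbr (N ∘ suc) X)) (bound b))
  where
  bound : ∀ b → ∣ (if b then N zero else ⊥) ∣ + ∣ nbr (N ∘ suc) X ∣ ≤ weight (∣_∣ ∘ N) (b ∷ X)
  bound true  = +-monoʳ-≤ ∣ N zero ∣ (∣nbr∣≤weight (N ∘ suc) X)
  bound false = subst (λ k → k + ∣ nbr (N ∘ suc) X ∣ ≤ weight (∣_∣ ∘ N ∘ suc) X)
    (sym (∣⊥∣≡0 q)) (∣nbr∣≤weight (N ∘ suc) X)

-- Hall's theorem with demands

Hall : (Fin m → ℕ) → (Fin m → Subset q) → Set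
Hall d N = ∀ X → weight d X ≤ ∣ nbr N X ∣

abstract

  remove : (Fin m → Subset q) → Fin m → Fin q → Fin m → Subset q
  remove N i c u = if does (u ≟ᶠ i) then N u - c else N u

  remove-⊆ : (N : Fin m → Subset q) (i : Fin m) (c : Fin q) → ∀ u → remove N i c u ⊆ N u
  remove-⊆ N i c u with u ≟ᶠ i
  ... | yes _ = p─q⊆p (N u) ⁅ c ⁆
  ... | no  _ = λ x → x

  remove-∋ : {N : Fin m → Subset q} {i : Fin m} {c : Fin q} → ∀ {u y} →
    y ∈ N u → ¬ (u ≡ i × y ≡ c) → y ∈ remove N i c u
  remove-∋ {i = i} {u = u} y∈ ¬uc with u ≟ᶠ i
  ... | yes u≡i = x∈p∧x≢y⇒x∈p-y y∈ (λ y≡c → ¬uc (u≡i , y≡c))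
  ... | no  _   = y∈

  remove-∣∣ : (N : Fin m → Subset q) {i : Fin m} {c : Fin q} →
    c ∈ N i → ∣ remove N i c i ∣ < ∣ N i ∣
  remove-∣∣ N {i} c∈ with i ≟ᶠ i
  ... | yes _   = x∈p⇒∣p-x∣<∣p∣ c∈
  ... | no  i≢i = contradiction refl i≢i

module _ (N : Fin m → Subset q) (i : Fin m) (c : Fin q) where

  -- A removal costs a neighbourhood at most one cell, so a set that violates the condition
  -- afterwards was tight before. A cell is really lost only if `i` is in the set and is its only
  -- member that sees `c`.
  tight : (d : Fin m → ℕ) → Hall d N → ∀ X → ¬ (weight d X ≤ ∣ nbr (remove N i c) X ∣) →
    ∣ nbr N X ∣ ≤ weight d X × i ∈ X × (∀ u → u ∈ X → c ∈ N u → u ≡ i)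
  tight d hall X viol =
    ≤-trans (∣-∣ (nbr N X) c) (≤-trans (s≤s (p⊆q⇒∣p∣≤∣q∣ sub)) (≰⇒> viol)) ,
    decidable-stable (i ∈? X) (λ i∉X → viol (≤-trans (hall X) (p⊆q⇒∣p∣≤∣q∣ (avoid i∉X)))) ,
    λ u u∈X c∈Nu → decidable-stable (u ≟ᶠ i) λ u≢i →
      viol (≤-trans (hall X) (p⊆q⇒∣p∣≤∣q∣ (reroute u u∈X c∈Nu u≢i)))
    where
    avoid : i ∉ X → nbr N X ⊆ nbr (remove N i c) X
    avoid i∉X y∈ = let u , u∈X , y∈Nu = ∈nbr⁻ y∈ in
      ∈nbr⁺ u∈X (remove-∋ y∈Nu λ { (refl , _) → i∉X u∈X })
    sub : nbr N X - c ⊆ nbr (remove N i c) X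
    sub y∈ = let y∈N , y∉c = x∈p─q⁻ (nbr N X) ⁅ c ⁆ y∈
                 u , u∈X , y∈Nu = ∈nbr⁻ y∈N
             in ∈nbr⁺ u∈X (remove-∋ y∈Nu λ { (_ , refl) → y∉c (x∈⁅x⁆ c) })
    reroute : ∀ u → u ∈ X → c ∈ N u → ¬ (u ≡ i) → nbr N X ⊆ nbr (remove N i c) X
    reroute u u∈X c∈Nu u≢i {y} y∈ with y ≟ᶠ c | ∈nbr⁻ y∈
    ... | yes refl | _ = ∈nbr⁺ u∈X (remove-∋ c∈Nu λ { (u≡i , _) → u≢i u≡i })
    ... | no y≢c   | v , v∈X , y∈Nv = ∈nbr⁺ v∈X (remove-∋ y∈Nv λ { (_ , y≡c) → y≢c y≡c })

hall? : (d : Fin m → ℕ) (N : Fin m → Subset q) →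
  (∃ λ X → ¬ (weight d X ≤ ∣ nbr N X ∣)) ⊎ Hall d N
hall? d N with anySubset? (λ X → ¬? (weight d X ≤? ∣ nbr N X ∣))
... | yes viol = inj₁ viol
... | no  ¬viol = inj₂ λ X → decidable-stable (weight d X ≤? _) (λ ¬h → ¬viol (X , ¬h))

record Private (d : Fin m → ℕ) (N : Fin m → Subset q) : Set where
  field
    own      : Fin m → Subset q
    own-⊆    : ∀ u → own u ⊆ N u
    own-uniq : ∀ {u v c} → c ∈ own u → c ∈ own v → u ≡ v
    own-≥    : ∀ u → d u ≤ ∣ own u ∣

-- Rado's proof: a cell c shared by i ≠ j can be removed from N i or from N j, since otherwise
-- submodularity of X ↦ ∣ nbr N X ∣ on the two tight sets contradicts the Hall condition.
module _ (d : Fin m → ℕ) where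

  removable : (N : Fin m → Subset q) → Hall d N → ∀ {i j c} → i ≢ j → c ∈ N i → c ∈ N j →
    Hall d (remove N i c) ⊎ Hall d (remove N j c)
  removable N hall {i} {j} {c} i≢j c∈Ni c∈Nj with hall? d (remove N i c) | hall? d (remove N j c)
  ... | inj₂ h | _      = inj₁ h
  ... | _      | inj₂ h = inj₂ h
  ... | inj₁ (X , vX) | inj₁ (Z , vZ) =
    let tX , i∈X , onlyX = tight N i c d hall X vX
        tZ , j∈Z , onlyZ = tight N j c d hall Z vZ
        c∈∩ : c ∈ nbr N X ∩ nbr N Z
        c∈∩ = x∈p∩q⁺ (∈nbr⁺ i∈X c∈Ni , ∈nbr⁺ j∈Z c∈Nj)
        c∉ : c ∉ nbr N (X ∩ Z)
        c∉ c∈ = let u , u∈ , c∈Nu = ∈nbr⁻ c∈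
                    u∈X , u∈Z = x∈p∩q⁻ X Z u∈
                in i≢j (trans (sym (onlyX u u∈X c∈Nu)) (onlyZ u u∈Z c∈Nu))
        strict : ∣ nbr N (X ∩ Z) ∣ < ∣ nbr N X ∩ nbr N Z ∣
        strict = p⊂q⇒∣p∣<∣q∣ ((λ y∈ → x∈p∩q⁺ (nbr-mono (p∩q⊆p X Z) y∈ , nbr-mono (p∩q⊆q X Z) y∈))
                             , c , c∈∩ , c∉)
    in contradiction (begin-strict
      weight d X + weight d Z                      ≡⟨ weight-∪-∩ d X Z ⟨
      weight d (X ∪ Z) + weight d (X ∩ Z)          ≤⟨ +-mono-≤ (hall (X ∪ Z)) (hall (X ∩ Z)) ⟩
      ∣ nbr N (X ∪ Z) ∣ + ∣ nbr N (X ∩ Z) ∣        <⟨ +-mono-≤-< (p⊆q⇒∣p∣≤∣q∣ (nbr-∪ N X Z)) strict ⟩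
      ∣ nbr N X ∪ nbr N Z ∣ + ∣ nbr N X ∩ nbr N Z ∣ ≡⟨ ∣∪∣+∣∩∣ (nbr N X) (nbr N Z) ⟩
      ∣ nbr N X ∣ + ∣ nbr N Z ∣                    ≤⟨ +-mono-≤ tX tZ ⟩
      weight d X + weight d Z                      ∎) (<-irrefl refl)
    where open ≤-Reasoning

  -- Each removal lowers the total number of incidences, so the process stops; then no cell is
  -- shared, and the Hall condition for singletons meets the demands.
  hall-private : (N : Fin m → Subset q) → Hall d N → Private d N
  hall-private N hall = go N hall (<-wellFounded _)
    where
    go : (N : Fin m → Subset q) → Hall d N → Acc _<_ (weight (∣_∣ ∘ N) ⊤) → Private d N
    shrink : (N : Fin m → Subset q) → Acc _<_ (weight (∣_∣ ∘ N) ⊤) → ∀ {i c} → c ∈ N i →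
      Hall d (remove N i c) → Private d N
    shrink N (acc rs) {i} {c} c∈ h = record
      { own      = Private.own P
      ; own-⊆    = λ u → remove-⊆ N i c u ∘ Private.own-⊆ P u
      ; own-uniq = Private.own-uniq P
      ; own-≥    = Private.own-≥ P
      }
      where
      P : Private d (remove N i c)
      P = go (remove N i c) h (rs (weight-⊤-strict i (remove-∣∣ N c∈)
            (λ u → p⊆q⇒∣p∣≤∣q∣ (remove-⊆ N i c u))))
    go N hall ac with any? (λ i → any? λ j → any? λ c → ¬? (i ≟ᶠ j) ×-dec c ∈? N i ×-dec c ∈? N j)
    ... | yes (i , j , c , i≢j , c∈i , c∈j) =
      [ shrink N ac c∈i , shrink N ac c∈j ]′ (removable N hall i≢j c∈i c∈j)
    ... | no disj = record
      { own      = N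
      ; own-⊆    = λ _ x → x
      ; own-uniq = λ {u} {v} {c} c∈u c∈v → decidable-stable (u ≟ᶠ v) λ u≢v →
                     disj (u , v , c , u≢v , c∈u , c∈v)
      ; own-≥    = λ u → subst₂ _≤_ (weight-⁅⁆ d u) refl
                     (≤-trans (hall ⁅ u ⁆) (p⊆q⇒∣p∣≤∣q∣ (nbr-⁅⁆ N u)))
      }

-- Single-element extensions, complements and maximal subsets

∣∪⁅⁆∣ : (X : Subset m) {u : Fin m} → u ∉ X → ∣ X ∪ ⁅ u ⁆ ∣ ≡ suc ∣ X ∣
∣∪⁅⁆∣ X {u} u∉X = begin
  ∣ X ∪ ⁅ u ⁆ ∣      ≡⟨ ∣∪∣-disjoint X ⁅ u ⁆ (λ x∈X x∈u → u∉X (subst (_∈ X) (x∈⁅y⁆⇒x≡y u x∈u) x∈X)) ⟩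
  ∣ X ∣ + ∣ ⁅ u ⁆ ∣  ≡⟨ cong (∣ X ∣ +_) (∣⁅x⁆∣≡1 u) ⟩
  ∣ X ∣ + 1          ≡⟨ +-comm ∣ X ∣ 1 ⟩
  suc ∣ X ∣          ∎
  where open ≡-Reasoning

∉⇒∣∣< : {p : Subset (suc n)} {z : Fin (suc n)} → z ∉ p → ∣ p ∣ ≤ n
∉⇒∣∣< {n} {p} {z} z∉p = s≤s⁻¹ (begin
  suc ∣ p ∣      ≡⟨ ∣∪⁅⁆∣ p z∉p ⟨
  ∣ p ∪ ⁅ z ⁆ ∣  ≤⟨ ∣p∣≤n (p ∪ ⁅ z ⁆) ⟩
  suc n          ∎)
  where
  open ≤-Reasoning

∉∉⇒∣∣< : {p : Subset (2 + n)} {z z′ : Fin (2 + n)} → z ≢ z′ → z ∉ p → z′ ∉ p → ∣ p ∣ ≤ n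
∉∉⇒∣∣< {n} {p} {z} {z′} z≢z′ z∉p z′∉p = s≤s⁻¹ (begin
  suc ∣ p ∣      ≡⟨ ∣∪⁅⁆∣ p z∉p ⟨
  ∣ p ∪ ⁅ z ⁆ ∣  ≤⟨ ∉⇒∣∣< ([ z′∉p , (λ z′∈ → z≢z′ (sym (x∈⁅y⁆⇒x≡y z z′∈))) ]′ ∘ x∈p∪q⁻ p ⁅ z ⁆) ⟩
  suc n          ∎)
  where
  open ≤-Reasoning

∣p─q∣+∣q∣ : {p q : Subset n} → q ⊆ p → ∣ p ∣ ≡ ∣ q ∣ + ∣ p ─ q ∣
∣p─q∣+∣q∣ {p = p} {q} q⊆p = begin
  ∣ p ∣              ≡⟨ cong ∣_∣ (⊆-antisym split ([ q⊆p , p─q⊆p p q ]′ ∘ x∈p∪q⁻ q (p ─ q))) ⟩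
  ∣ q ∪ (p ─ q) ∣    ≡⟨ ∣∪∣-disjoint q (p ─ q) (λ x∈q x∈p─q → proj₂ (x∈p─q⁻ p q x∈p─q) x∈q) ⟩
  ∣ q ∣ + ∣ p ─ q ∣  ∎
  where
  open ≡-Reasoning
  split : p ⊆ q ∪ (p ─ q)
  split {x} x∈p with x ∈? q
  ... | yes x∈q = x∈p∪q⁺ (inj₁ x∈q)
  ... | no  x∉q = x∈p∪q⁺ (inj₂ (x∈p∧x∉q⇒x∈p─q x∈p x∉q))

largest : {P : Subset m → Set} → Decidable P → ∃ P → ∃ λ R → P R × (∀ X → P X → ∣ X ∣ ≤ ∣ R ∣)
largest {m} {P} P? (X , PX) = go m X PX (m≤n+m m ∣ X ∣)
  where
  go : ∀ fuel R → P R → m ≤ ∣ R ∣ + fuel → ∃ λ R → P R × (∀ X → P X → ∣ X ∣ ≤ ∣ R ∣)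
  go fuel R PR m≤ with anySubset? (λ X → P? X ×-dec ∣ R ∣ <? ∣ X ∣)
  ... | no max = R , PR , λ X PX → ≮⇒≥ (λ R<X → max (X , PX , R<X))
  go zero R PR m≤ | yes (X , _ , R<X) =
    contradiction (≤-trans R<X (≤-trans (∣p∣≤n X) (≤-trans m≤ (≤-reflexive (+-identityʳ _))))) (<-irrefl refl)
  go (suc fuel) R PR m≤ | yes (X , PX , R<X) =
    go fuel X PX (≤-trans m≤ (≤-trans (≤-reflexive (+-suc _ fuel)) (+-monoˡ-≤ fuel R<X)))

-- W is a connected piece of Z, grown until it is a component or has size c; the bound |W| + 1 on
-- its neighbourhood persists, since each new element shares one of its two cells with W.
module _ (E : Fin m → Subset q) (∣E∣≤2 : ∀ u → ∣ E u ∣ ≤ 2) (Y : Subset m) (c : ℕ) (c≥1 : 1 ≤ c)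
  (small : ∀ W → W ⊆ Y → ∣ W ∣ < c → ∣ W ∣ ≤ ∣ nbr E W ∣)
  (large : ∀ W → W ⊆ Y → ∣ W ∣ ≡ c → 2 + ∣ W ∣ ≤ ∣ nbr E W ∣) where

  private
    Good : Subset m → Set
    Good Z = Z ⊆ Y → ∣ Z ∣ ≤ ∣ nbr E Z ∣

  grow : ∀ Z → (∀ Z′ → ∣ Z′ ∣ < ∣ Z ∣ → Good Z′) → Z ⊆ Y → ∀ fuel W → W ⊆ Z → Nonempty W →
    ∣ nbr E W ∣ ≤ suc ∣ W ∣ → c ≡ ∣ W ∣ + fuel → ∣ Z ∣ ≤ ∣ nbr E Z ∣
  grow Z ih Z⊆Y zero W W⊆Z _ tree c≡ =
    contradiction (≤-trans (large W (Z⊆Y ∘ W⊆Z) (sym (trans c≡ (+-identityʳ _)))) tree) (<-irrefl refl)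
  grow Z ih Z⊆Y (suc fuel) W W⊆Z (w , w∈W) tree c≡
    with any? (λ u → u ∈? Z ×-dec ¬? (u ∈? W) ×-dec nonempty? (nbr E W ∩ E u))
  ... | yes (u , u∈Z , u∉W , x , x∈) =
    grow Z ih Z⊆Y fuel (W ∪ ⁅ u ⁆)
      ([ W⊆Z , (λ v∈ → subst (_∈ Z) (sym (x∈⁅y⁆⇒x≡y u v∈)) u∈Z) ]′ ∘ x∈p∪q⁻ W ⁅ u ⁆)
      (w , x∈p∪q⁺ (inj₁ w∈W)) tree′
      (trans c≡ (trans (+-suc ∣ W ∣ fuel) (cong (_+ fuel) (sym (∣∪⁅⁆∣ W u∉W)))))
    where
    open ≤-Reasoning
    shared : 1 ≤ ∣ nbr E W ∩ E u ∣
    shared = subst (_≤ ∣ nbr E W ∩ E u ∣) (∣⁅x⁆∣≡1 x)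
      (p⊆q⇒∣p∣≤∣q∣ (λ y∈ → subst (_∈ nbr E W ∩ E u) (sym (x∈⁅y⁆⇒x≡y x y∈)) x∈))
    sub : nbr E (W ∪ ⁅ u ⁆) ⊆ nbr E W ∪ E u
    sub y∈ = x∈p∪q⁺ ([ inj₁ , inj₂ ∘ nbr-⁅⁆ E u ]′
      (x∈p∪q⁻ (nbr E W) (nbr E ⁅ u ⁆) (nbr-∪ E W ⁅ u ⁆ y∈)))
    tree′ : ∣ nbr E (W ∪ ⁅ u ⁆) ∣ ≤ suc ∣ W ∪ ⁅ u ⁆ ∣
    tree′ = +-cancelʳ-≤ 1 _ _ (begin
      ∣ nbr E (W ∪ ⁅ u ⁆) ∣ + 1                ≤⟨ +-mono-≤ (p⊆q⇒∣p∣≤∣q∣ sub) shared ⟩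
      ∣ nbr E W ∪ E u ∣ + ∣ nbr E W ∩ E u ∣    ≡⟨ ∣∪∣+∣∩∣ (nbr E W) (E u) ⟩
      ∣ nbr E W ∣ + ∣ E u ∣                    ≤⟨ +-mono-≤ tree (∣E∣≤2 u) ⟩
      suc ∣ W ∣ + 2                            ≡⟨ +-suc (suc ∣ W ∣) 1 ⟩
      suc (suc ∣ W ∣) + 1                      ≡⟨ cong (λ k → suc k + 1) (∣∪⁅⁆∣ W u∉W) ⟨
      suc ∣ W ∪ ⁅ u ⁆ ∣ + 1                    ∎)
  ... | no component = begin
    ∣ Z ∣                              ≡⟨ ∣p─q∣+∣q∣ W⊆Z ⟩
    ∣ W ∣ + ∣ Z ─ W ∣                  ≤⟨ +-mono-≤
        (small W (Z⊆Y ∘ W⊆Z) (≤-trans (m≤m+n _ fuel) (≤-reflexive (sym (trans c≡ (+-suc _ fuel))))))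
        (ih (Z ─ W) smaller (Z⊆Y ∘ p─q⊆p Z W)) ⟩
    ∣ nbr E W ∣ + ∣ nbr E (Z ─ W) ∣    ≡⟨ ∣∪∣-disjoint (nbr E W) (nbr E (Z ─ W)) disjoint ⟨
    ∣ nbr E W ∪ nbr E (Z ─ W) ∣        ≤⟨ p⊆q⇒∣p∣≤∣q∣
        ([ nbr-mono W⊆Z , nbr-mono (p─q⊆p Z W) ]′ ∘ x∈p∪q⁻ (nbr E W) (nbr E (Z ─ W))) ⟩
    ∣ nbr E Z ∣                        ∎
    where
    open ≤-Reasoning
    smaller : ∣ Z ─ W ∣ < ∣ Z ∣
    smaller = p∩q≢∅⇒∣p─q∣<∣p∣ Z W (w , x∈p∩q⁺ (W⊆Z w∈W , w∈W))
    disjoint : Disjoint (nbr E W) (nbr E (Z ─ W))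
    disjoint y∈W y∈ = let v , v∈ , y∈Ev = ∈nbr⁻ y∈
                          v∈Z , v∉W = x∈p─q⁻ Z W v∈
                      in component (v , v∈Z , v∉W , _ , x∈p∩q⁺ (y∈W , y∈Ev))

  -- Read elements as edges and cells as vertices. A connected graph with `c` edges has at most
  -- `c + 1` vertices, which `large` forbids; so every component has fewer than `c` edges and obeys
  -- `small`, and components have disjoint neighbourhoods.
  hall-from-small : ∀ Z → Good Z
  hall-from-small Z = go Z (<-wellFounded ∣ Z ∣)
    where
    go : ∀ Z → Acc _<_ ∣ Z ∣ → Good Z
    go Z (acc rs) Z⊆Y with nonempty? Z
    ... | no ∅ = ≤-trans (≤-reflexive (Empty⇒∣∣≡0 ∅)) z≤n
    ... | yes (y , y∈Z) = grow Z (λ Z′ Z′<Z → go Z′ (rs Z′<Z)) Z⊆Y (c ∸ 1) ⁅ y ⁆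
      (λ x∈ → subst (_∈ Z) (sym (x∈⁅y⁆⇒x≡y y x∈)) y∈Z) (y , x∈⁅x⁆ y)
      (≤-trans (p⊆q⇒∣p∣≤∣q∣ (nbr-⁅⁆ E y))
        (≤-trans (∣E∣≤2 y) (≤-reflexive (cong suc (sym (∣⁅x⁆∣≡1 y))))))
      (trans (sym (m+[n∸m]≡n c≥1)) (cong (_+ (c ∸ 1)) (sym (∣⁅x⁆∣≡1 y))))

-- The cells of an element and the nodes they serve

cells : Vec (Fin q) n → Subset q
cells []       = ⊥
cells (x ∷ xs) = ⁅ x ⁆ ∪ cells xs

∈cells⁺ : (xs : Vec (Fin q) n) (z : Fin n) → lookup xs z ∈ cells xs
∈cells⁺ (x ∷ xs) zero    = x∈p∪q⁺ (inj₁ (x∈⁅x⁆ x))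
∈cells⁺ (x ∷ xs) (suc z) = x∈p∪q⁺ (inj₂ (∈cells⁺ xs z))

∈cells⁻ : (xs : Vec (Fin q) n) {c : Fin q} → c ∈ cells xs → ∃ λ z → lookup xs z ≡ c
∈cells⁻ [] c∈ = contradiction c∈ ∉⊥
∈cells⁻ (x ∷ xs) c∈ with x∈p∪q⁻ ⁅ x ⁆ (cells xs) c∈
... | inj₁ c∈x = zero , sym (x∈⁅y⁆⇒x≡y x c∈x)
... | inj₂ c∈xs = let z , eq = ∈cells⁻ xs c∈xs in suc z , eq

-- Nodes are counted, not cells: a cell may serve several nodes, and all of them are then controlled
-- by its owner, since each node has its own table. Hence owning four cells means controlling at
-- least four nodes.
positions : Subset q → Vec (Fin q) n → Subset n
positions P xs = map (lookup P) xs

∈positions⁻ : {P : Subset q} (xs : Vec (Fin q) n) {z : Fin n} → z ∈ positions P xs → lookup xs z ∈ P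
∈positions⁻ {P = P} xs {z} h = lookup⇒[]= _ P (trans (sym (lookup-map z _ xs)) ([]=⇒lookup h))

∣∩cells∣ : (P : Subset q) (xs : Vec (Fin q) n) → ∣ P ∩ cells xs ∣ ≤ ∣ positions P xs ∣
∣∩cells∣ P [] = ≤-reflexive (Empty⇒∣∣≡0 λ { (x , x∈) → ∉⊥ (proj₂ (x∈p∩q⁻ P ⊥ x∈)) })
∣∩cells∣ {q} P (x ∷ xs) = ≤-trans (p⊆q⇒∣p∣≤∣q∣ split)
    (≤-trans (∣∪∣≤ (P ∩ ⁅ x ⁆) (P ∩ cells xs)) (bound (lookup P x) refl))
  where
  split : P ∩ (⁅ x ⁆ ∪ cells xs) ⊆ (P ∩ ⁅ x ⁆) ∪ (P ∩ cells xs)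
  split y∈ = let y∈P , y∈∪ = x∈p∩q⁻ P _ y∈ in
    x∈p∪q⁺ ([ (λ h → inj₁ (x∈p∩q⁺ (y∈P , h))) , (λ h → inj₂ (x∈p∩q⁺ (y∈P , h))) ]′
      (x∈p∪q⁻ ⁅ x ⁆ (cells xs) y∈∪))
  bound : ∀ b → lookup P x ≡ b → ∣ P ∩ ⁅ x ⁆ ∣ + ∣ P ∩ cells xs ∣ ≤ ∣ b ∷ positions P xs ∣
  bound true  _  = +-mono-≤ (≤-trans (∣p∩q∣≤∣q∣ P ⁅ x ⁆) (≤-reflexive (∣⁅x⁆∣≡1 x))) (∣∩cells∣ P xs)
  bound false eq = subst (λ k → k + ∣ P ∩ cells xs ∣ ≤ ∣ positions P xs ∣) (sym (Empty⇒∣∣≡0 ∅)) (∣∩cells∣ P xs)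
    where
    ∅ : Empty (P ∩ ⁅ x ⁆)
    ∅ (y , y∈) = let y∈P , y∈x = x∈p∩q⁻ P ⁅ x ⁆ y∈ in
      case trans (sym eq) (trans (cong (lookup P) (sym (x∈⁅y⁆⇒x≡y x y∈x))) ([]=⇒lookup y∈P)) of λ ()

-- The query tree and the memory it reads

slot : Bool → Bool → Fin 4
slot false false = zero
slot false true  = suc zero
slot true  false = suc (suc zero)
slot true  true  = suc (suc (suc zero))

rowOf colOf : Fin 4 → Bool
rowOf zero          = false
rowOf (suc zero)    = false
rowOf (suc (suc _)) = true
colOf zero                = false
colOf (suc zero)          = true
colOf (suc (suc zero))    = false
colOf (suc (suc (suc _))) = true

rowOf-slot : ∀ a b → rowOf (slot a b) ≡ a
rowOf-slot false false = refl
rowOf-slot false true  = refl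
rowOf-slot true  false = refl
rowOf-slot true  true  = refl

colOf-slot : ∀ a b → colOf (slot a b) ≡ b
colOf-slot false false = refl
colOf-slot false true  = refl
colOf-slot true  false = refl
colOf-slot true  true  = refl

pattern nodeA = zero
pattern nodeB = suc zero

leafNode : Bool → Bool → Fin 6
leafNode a b = suc (suc (slot a b))

module _ (x : Vec (Fin q) 6) where

  at : Fin 6 → Fin (6 * q)
  at z = combine z (lookup x z)

  tip : Bool → Bool → DTree (6 * q)
  tip a b = node (at (leafNode a b)) (leaf false) (leaf true)

  tree : DTree (6 * q)
  tree = node (at nodeA) (node (at nodeB) (tip false false) (tip false true))
                         (node (at nodeB) (tip true false) (tip true true))

  depth-tree : depth tree ≤ 3
  depth-tree = ≤-refl

  module _ (w : Vec Bool (6 * q)) where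

    eval-tip : ∀ a b → eval (tip a b) w ≡ lookup w (at (leafNode a b))
    eval-tip a b with lookup w (at (leafNode a b))
    ... | true  = refl
    ... | false = refl

    eval-tree : eval tree w ≡ lookup w (at (leafNode (lookup w (at nodeA)) (lookup w (at nodeB))))
    eval-tree with lookup w (at nodeA) | lookup w (at nodeB)
    ... | true  | true  = eval-tip true  true
    ... | true  | false = eval-tip true  false
    ... | false | true  = eval-tip false true
    ... | false | false = eval-tip false false

-- One table of q bits for each node; an element that owns a cell controls it in all six tables.
Memory : ℕ → Set
Memory q = Fin 6 → Fin q → Bool

read : Memory q → Vec (Fin q) 6 → Bool
read M x = M z (lookup x z)
  where z = leafNode (M nodeA (lookup x nodeA)) (M nodeB (lookup x nodeB))

store : Memory q → Vec Bool (6 * q)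
store {q} M = tabulate (λ i → M (proj₁ (remQuot {6} q i)) (proj₂ (remQuot {6} q i)))

lookup-store : (M : Memory q) → ∀ z c → lookup (store M) (combine z c) ≡ M z c
lookup-store M z c = trans (lookup∘tabulate _ (combine z c))
  (cong (λ zc → M (proj₁ zc) (proj₂ zc)) (remQuot-combine z c))

eval-store : (M : Memory q) (x : Vec (Fin q) 6) → eval (tree x) (store M) ≡ read M x
eval-store M x = trans (eval-tree x (store M))
  (trans (cong₂ (λ a b → lookup (store M) (at x (leafNode a b)))
           (lookup-store M nodeA (lookup x nodeA)) (lookup-store M nodeB (lookup x nodeB)))
         (lookup-store M _ _))

∀-Bool? : {P : Bool → Set} → Decidable P → Dec (∀ b → P b)
∀-Bool? P? = map′ (λ { (f , t) false → f ; (f , t) true → t }) (λ h → h false , h true)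
  (P? false ×-dec P? true)

-- The bits at nodes outside p are beyond control, but whatever they are the query ends at a leaf in p.
Steerable : Subset 6 → Bool → Bool → Set
Steerable p a b = ∀ a′ b′ → (nodeA ∈ p → a′ ≡ a) → (nodeB ∈ p → b′ ≡ b) → leafNode a′ b′ ∈ p

steerable? : ∀ p → Dec (∃₂ (Steerable p))
steerable? p = ∃-Bool? λ a → ∃-Bool? λ b → ∀-Bool? λ a′ → ∀-Bool? λ b′ →
  (nodeA ∈? p →-dec a′ ≟ᵇ a) →-dec (nodeB ∈? p →-dec b′ ≟ᵇ b) →-dec leafNode a′ b′ ∈? p
  where
  ∃-Bool? : {P : Bool → Set} → Decidable P → Dec (∃ P)
  ∃-Bool? P? with P? false | P? true
  ... | yes f | _     = yes (false , f)
  ... | no _  | yes t = yes (true , t)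
  ... | no ¬f | no ¬t = no λ { (false , f) → ¬f f ; (true , t) → ¬t t }

-- With A and B both in `p`, any leaf in `p` can be aimed at. With only one of them, at least three
-- leaves are in `p`, so both leaves on one side of that node are. With neither, all four leaves
-- are. The proof runs through all subsets.
4≤⇒steerable : ∀ p → 4 ≤ ∣ p ∣ → ∃₂ (Steerable p)
4≤⇒steerable p 4≤p = decidable-stable (steerable? p) λ ¬st →
  from-no (anySubset? (λ p → 4 ≤? ∣ p ∣ ×-dec ¬? (steerable? p))) (p , 4≤p , ¬st)

does⇒ : {A : Set} (A? : Dec A) → does A? ≡ true → A
does⇒ (yes a) _ = a

-- Encoding a set with an expander

-- The `2 * n` is the allowance of `Candidate`, so no candidate reaches size `k₀`. The 2 beyond it
-- is what `hall-from-small` asks of sets of the critical size.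
record Expands {m q} (n k₀ : ℕ) (Γ : Fin m → Subset q) : Set where
  field
    small : ∀ R → ∣ R ∣ ≤ k₀ → 4 * ∣ R ∣ ≤ ∣ nbr Γ R ∣
    large : ∀ R → ∣ R ∣ ≡ k₀ → 4 * k₀ + 2 * n + 2 ≤ ∣ nbr Γ R ∣

weight-bits : ∀ a b (R Y X : Subset m) →
  weight (λ u → a * bit (lookup R u) + b * bit (lookup Y u)) X ≡ a * ∣ X ∩ R ∣ + b * ∣ X ∩ Y ∣
weight-bits a b [] [] [] = sym (cong₂ _+_ (*-zeroʳ a) (*-zeroʳ b))
weight-bits a b (_ ∷ R) (_ ∷ Y) (false ∷ X) = weight-bits a b R Y X
weight-bits a b (r ∷ R) (y ∷ Y) (true ∷ X) = begin
  (a * bit r + b * bit y) + weight (λ u → a * bit (lookup R u) + b * bit (lookup Y u)) X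
    ≡⟨ cong (a * bit r + b * bit y +_) (weight-bits a b R Y X) ⟩
  (a * bit r + b * bit y) + (a * ∣ X ∩ R ∣ + b * ∣ X ∩ Y ∣)
    ≡⟨ lemma a b (bit r) (bit y) (∣ X ∩ R ∣) (∣ X ∩ Y ∣) ⟩
  a * (bit r + ∣ X ∩ R ∣) + b * (bit y + ∣ X ∩ Y ∣)
    ≡⟨ cong₂ (λ i j → a * i + b * j) (head-bit r (X ∩ R)) (head-bit y (X ∩ Y)) ⟩
  a * ∣ r ∷ X ∩ R ∣ + b * ∣ y ∷ X ∩ Y ∣ ∎
  where
  open ≡-Reasoning
  lemma : ∀ a b r y i j → (a * r + b * y) + (a * i + b * j) ≡ a * (r + i) + b * (y + j)
  lemma = solve-∀
  head-bit : ∀ b (p : Subset n) → bit b + ∣ p ∣ ≡ ∣ b ∷ p ∣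
  head-bit true  p = refl
  head-bit false p = refl

1≤∣∣⇒Nonempty : (p : Subset n) → 1 ≤ ∣ p ∣ → Nonempty p
1≤∣∣⇒Nonempty p 1≤ = decidable-stable (nonempty? p) λ ∅ →
  contradiction (subst (1 ≤_) (Empty⇒∣∣≡0 ∅) 1≤) λ ()

Nonempty⇒1≤∣∣ : {p : Subset n} → Nonempty p → 1 ≤ ∣ p ∣
Nonempty⇒1≤∣∣ {p = p} (x , x∈) = subst (_≤ ∣ p ∣) (∣⁅x⁆∣≡1 x)
  (p⊆q⇒∣p∣≤∣q∣ λ y∈ → subst (_∈ p) (sym (x∈⁅y⁆⇒x≡y x y∈)) x∈)

tops : Vec (Fin q) 6 → Vec (Fin q) 2
tops x = lookup x nodeA ∷ lookup x nodeB ∷ []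

leaves : Vec (Fin q) 6 → Vec (Fin q) 4
leaves x = tabulate (λ z → lookup x (suc (suc z)))

cells-split : (x : Vec (Fin q) 6) → cells x ⊆ cells (tops x) ∪ cells (leaves x)
cells-split x c∈ with ∈cells⁻ x c∈
... | zero , refl          = x∈p∪q⁺ (inj₁ (∈cells⁺ (tops x) zero))
... | suc zero , refl      = x∈p∪q⁺ (inj₁ (∈cells⁺ (tops x) (suc zero)))
... | suc (suc z) , refl   = x∈p∪q⁺ (inj₂
  (subst (_∈ cells (leaves x)) (lookup∘tabulate (λ z → lookup x (suc (suc z))) z) (∈cells⁺ (leaves x) z)))

-- R is a largest superset of S that expands by little more than the factor 4. By maximality every other
-- element sees at most one cell of G = Γ R; those in Y see one at a leaf, which they have to avoid.
module Encode {m q n k₀ : ℕ} (g : Fin m → Vec (Fin q) 6) (expands : Expands n k₀ (cells ∘ g))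
  (n≤k₀ : n ≤ k₀) (S : Subset m) (∣S∣≤n : ∣ S ∣ ≤ n) where

  open Expands expands
  open ≤-Reasoning

  Γ : Subset m → Subset q
  Γ = nbr (cells ∘ g)

  Candidate : Subset m → Set
  Candidate R = S ⊆ R × ∣ R ∣ ≤ k₀ × ∣ Γ R ∣ ≤ 4 * ∣ R ∣ + 2 * n

  ∣cells∣ : (x : Vec (Fin q) 6) → ∣ cells x ∣ ≤ 6
  ∣cells∣ x = begin
    ∣ cells x ∣         ≤⟨ p⊆q⇒∣p∣≤∣q∣ {p = cells x} {⊤ ∩ cells x} (λ c∈ → x∈p∩q⁺ (∈⊤ , c∈)) ⟩
    ∣ ⊤ ∩ cells x ∣     ≤⟨ ∣∩cells∣ ⊤ x ⟩
    ∣ positions ⊤ x ∣   ≤⟨ ∣p∣≤n (positions ⊤ x) ⟩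
    6                   ∎

  -- Six cells per element are 4 + 2, and `S` has at most `n` elements: the allowance `2 * n` is
  -- chosen for this.
  candidate-S : Candidate S
  candidate-S = (λ x → x) , ≤-trans ∣S∣≤n n≤k₀ , (begin
    ∣ Γ S ∣                        ≤⟨ ∣nbr∣≤weight (cells ∘ g) S ⟩
    weight (∣_∣ ∘ cells ∘ g) S     ≤⟨ weight-mono S (λ {u} _ → ∣cells∣ (g u)) ⟩
    weight (const 6) S             ≡⟨ weight-const 6 S ⟩
    6 * ∣ S ∣                      ≡⟨ *-distribʳ-+ ∣ S ∣ 4 2 ⟩
    4 * ∣ S ∣ + 2 * ∣ S ∣          ≤⟨ +-monoʳ-≤ (4 * ∣ S ∣) (*-monoʳ-≤ 2 ∣S∣≤n) ⟩
    4 * ∣ S ∣ + 2 * n              ∎)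

  candidate? : Decidable Candidate
  candidate? R = S ⊆? R ×-dec ∣ R ∣ ≤? k₀ ×-dec ∣ Γ R ∣ ≤? 4 * ∣ R ∣ + 2 * n

  abstract
    R-data : ∃ λ R → Candidate R × (∀ X → Candidate X → ∣ X ∣ ≤ ∣ R ∣)
    R-data = largest candidate? (S , candidate-S)

  R : Subset m
  R = proj₁ R-data

  G : Subset q
  G = Γ R

  S⊆R : S ⊆ R
  S⊆R = proj₁ (proj₁ (proj₂ R-data))

  ∣R∣≤k₀ : ∣ R ∣ ≤ k₀
  ∣R∣≤k₀ = proj₁ (proj₂ (proj₁ (proj₂ R-data)))

  ∣G∣≤ : ∣ G ∣ ≤ 4 * ∣ R ∣ + 2 * n
  ∣G∣≤ = proj₂ (proj₂ (proj₁ (proj₂ R-data)))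

  ∣R∣<k₀ : ∣ R ∣ < k₀
  ∣R∣<k₀ = ≤∧≢⇒< ∣R∣≤k₀ λ R≡k₀ → contradiction (begin-strict
    4 * k₀ + 2 * n       <⟨ m<m+n (4 * k₀ + 2 * n) (s≤s z≤n) ⟩
    4 * k₀ + 2 * n + 2   ≤⟨ large R R≡k₀ ⟩
    ∣ G ∣                ≤⟨ ∣G∣≤ ⟩
    4 * ∣ R ∣ + 2 * n    ≡⟨ cong (λ k → 4 * k + 2 * n) R≡k₀ ⟩
    4 * k₀ + 2 * n       ∎) (<-irrefl refl)

  -- By maximality `R ∪ Z` is not a candidate, and the bound on the neighbourhood is the only
  -- condition left to fail.
  escape : ∀ Z → Disjoint R Z → Nonempty Z → ∣ R ∣ + ∣ Z ∣ ≤ k₀ →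
    4 * (∣ R ∣ + ∣ Z ∣) + 2 * n < ∣ Γ (R ∪ Z) ∣
  escape Z R#Z Z≢∅ R+Z≤k₀ = ≰⇒> λ ΓRZ≤ → contradiction (begin-strict
    ∣ R ∣          <⟨ m<m+n ∣ R ∣ (Nonempty⇒1≤∣∣ Z≢∅) ⟩
    ∣ R ∣ + ∣ Z ∣  ≡⟨ ∣RZ∣ ⟨
    ∣ R ∪ Z ∣      ≤⟨ proj₂ (proj₂ R-data) (R ∪ Z)
                        ( (λ x∈S → x∈p∪q⁺ (inj₁ (S⊆R x∈S)))
                        , subst (_≤ k₀) (sym ∣RZ∣) R+Z≤k₀
                        , subst (λ k → ∣ Γ (R ∪ Z) ∣ ≤ 4 * k + 2 * n) (sym ∣RZ∣) ΓRZ≤) ⟩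
    ∣ R ∣          ∎) (<-irrefl refl)
    where
    ∣RZ∣ : ∣ R ∪ Z ∣ ≡ ∣ R ∣ + ∣ Z ∣
    ∣RZ∣ = ∣∪∣-disjoint R Z R#Z

  ∣∪∣≤∁ : (A : Subset q) → ∣ G ∪ A ∣ ≤ ∣ G ∣ + ∣ ∁ G ∩ A ∣
  ∣∪∣≤∁ A = ≤-trans (p⊆q⇒∣p∣≤∣q∣ split) (∣∪∣≤ G (∁ G ∩ A))
    where
    split : G ∪ A ⊆ G ∪ (∁ G ∩ A)
    split {x} x∈ with x ∈? G | x∈p∪q⁻ G A x∈
    ... | yes x∈G | _        = x∈p∪q⁺ (inj₁ x∈G)
    ... | no  x∉G | inj₁ x∈G = contradiction x∈G x∉G
    ... | no  x∉G | inj₂ x∈A = x∈p∪q⁺ (inj₂ (x∈p∩q⁺ (x∉p⇒x∈∁p x∉G , x∈A)))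

  module _ {u : Fin m} (u∉R : u ∉ R) where

    -- Otherwise `u` would bring at most four cells outside `G`, and adding it to `R` would give a
    -- larger candidate; there is room for it below `k₀`.
    outside-positions : 5 ≤ ∣ positions (∁ G) (g u) ∣
    outside-positions = +-cancelˡ-≤ (4 * ∣ R ∣ + 2 * n) _ _ (begin
      4 * ∣ R ∣ + 2 * n + 5                             ≡⟨ lemma ∣ R ∣ n ⟩
      suc (4 * (∣ R ∣ + 1) + 2 * n)                     ≡⟨ cong (λ k → suc (4 * (∣ R ∣ + k) + 2 * n)) (∣⁅x⁆∣≡1 u) ⟨
      suc (4 * (∣ R ∣ + ∣ ⁅ u ⁆ ∣) + 2 * n)             ≤⟨ escape ⁅ u ⁆ R#u (u , x∈⁅x⁆ u)
          (subst (λ k → ∣ R ∣ + k ≤ k₀) (sym (∣⁅x⁆∣≡1 u)) (subst (_≤ k₀) (+-comm 1 ∣ R ∣) ∣R∣<k₀)) ⟩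
      ∣ Γ (R ∪ ⁅ u ⁆) ∣                                 ≤⟨ p⊆q⇒∣p∣≤∣q∣ sub ⟩
      ∣ G ∪ cells (g u) ∣                               ≤⟨ ∣∪∣≤∁ (cells (g u)) ⟩
      ∣ G ∣ + ∣ ∁ G ∩ cells (g u) ∣                     ≤⟨ +-mono-≤ ∣G∣≤ (∣∩cells∣ (∁ G) (g u)) ⟩
      4 * ∣ R ∣ + 2 * n + ∣ positions (∁ G) (g u) ∣     ∎)
      where
      lemma : ∀ r n → 4 * r + 2 * n + 5 ≡ suc (4 * (r + 1) + 2 * n)
      lemma = solve-∀
      R#u : Disjoint R ⁅ u ⁆
      R#u x∈R x∈u = u∉R (subst (_∈ R) (x∈⁅y⁆⇒x≡y u x∈u) x∈R)
      sub : Γ (R ∪ ⁅ u ⁆) ⊆ G ∪ cells (g u)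
      sub c∈ = x∈p∪q⁺ ([ inj₁ , inj₂ ∘ nbr-⁅⁆ (cells ∘ g) u ]′
        (x∈p∪q⁻ G (Γ ⁅ u ⁆) (nbr-∪ (cells ∘ g) R ⁅ u ⁆ c∈)))

    one-collision : ∀ {z z′} → lookup (g u) z ∈ G → lookup (g u) z′ ∈ G → z ≡ z′
    one-collision {z} {z′} z∈ z′∈ = decidable-stable (z ≟ᶠ z′) λ z≢z′ →
      contradiction (≤-trans outside-positions (∉∉⇒∣∣< z≢z′ (avoid z∈) (avoid z′∈))) (<-irrefl refl)
      where
      avoid : ∀ {z} → lookup (g u) z ∈ G → z ∉ positions (∁ G) (g u)
      avoid z∈ z∈∁ = x∈∁p⇒x∉p (∈positions⁻ (g u) z∈∁) z∈

  Bad : Fin m → Set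
  Bad u = u ∉ R × ∃ λ z → lookup (g u) (suc (suc z)) ∈ G

  bad? : Decidable Bad
  bad? u = ¬? (u ∈? R) ×-dec any? (λ z → lookup (g u) (suc (suc z)) ∈? G)

  abstract
    Y : Subset m
    Y = ⟪ bad? ⟫

    ∈Y⁺ : ∀ {u} → Bad u → u ∈ Y
    ∈Y⁺ = ∈⟪⟫⁺ bad?

    ∈Y⁻ : ∀ {u} → u ∈ Y → Bad u
    ∈Y⁻ = ∈⟪⟫⁻ bad?

  E F : Fin m → Subset q
  E u = ∁ G ∩ cells (tops (g u))
  F u = ∁ G ∩ cells (leaves (g u))

  ∣E∣≤2 : ∀ u → ∣ E u ∣ ≤ 2
  ∣E∣≤2 u = ≤-trans (∣∩cells∣ (∁ G) (tops (g u))) (∣p∣≤n (positions (∁ G) (tops (g u))))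

  ∣F∣≤3 : ∀ {u} → u ∈ Y → ∣ F u ∣ ≤ 3
  ∣F∣≤3 {u} u∈Y = let _ , z , z∈G = ∈Y⁻ u∈Y in
    ≤-trans (∣∩cells∣ (∁ G) (leaves (g u))) (∉⇒∣∣< {z = z} λ z∈ →
      x∈∁p⇒x∉p (subst (_∈ ∁ G) (lookup∘tabulate (λ z → lookup (g u) (suc (suc z))) z)
                  (∈positions⁻ (leaves (g u)) z∈)) z∈G)

  module _ (W : Subset m) (W⊆Y : W ⊆ Y) where

    ∣Γ∪∣≤ : ∣ Γ (R ∪ W) ∣ ≤ 4 * ∣ R ∣ + 2 * n + (∣ nbr E W ∣ + 3 * ∣ W ∣)
    ∣Γ∪∣≤ = begin
      ∣ Γ (R ∪ W) ∣                          ≤⟨ p⊆q⇒∣p∣≤∣q∣ sub ⟩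
      ∣ G ∪ (nbr E W ∪ nbr F W) ∣            ≤⟨ ∣∪∣≤ G (nbr E W ∪ nbr F W) ⟩
      ∣ G ∣ + ∣ nbr E W ∪ nbr F W ∣          ≤⟨ +-monoʳ-≤ ∣ G ∣ (∣∪∣≤ (nbr E W) (nbr F W)) ⟩
      ∣ G ∣ + (∣ nbr E W ∣ + ∣ nbr F W ∣)    ≤⟨ +-mono-≤ ∣G∣≤ (+-monoʳ-≤ ∣ nbr E W ∣ (begin
          ∣ nbr F W ∣             ≤⟨ ∣nbr∣≤weight F W ⟩
          weight (∣_∣ ∘ F) W      ≤⟨ weight-mono W (λ u∈W → ∣F∣≤3 (W⊆Y u∈W)) ⟩
          weight (const 3) W      ≡⟨ weight-const 3 W ⟩
          3 * ∣ W ∣               ∎)) ⟩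
      4 * ∣ R ∣ + 2 * n + (∣ nbr E W ∣ + 3 * ∣ W ∣) ∎
      where
      sub : Γ (R ∪ W) ⊆ G ∪ (nbr E W ∪ nbr F W)
      sub {c} c∈ with c ∈? G | x∈p∪q⁻ G (Γ W) (nbr-∪ (cells ∘ g) R W c∈)
      ... | yes c∈G | _        = x∈p∪q⁺ (inj₁ c∈G)
      ... | no  c∉G | inj₁ c∈G = contradiction c∈G c∉G
      ... | no  c∉G | inj₂ c∈W with ∈nbr⁻ c∈W
      ...   | u , u∈W , c∈u = x∈p∪q⁺ (inj₂ (x∈p∪q⁺
        ([ (λ h → inj₁ (∈nbr⁺ u∈W (x∈p∩q⁺ (x∉p⇒x∈∁p c∉G , h))))
         , (λ h → inj₂ (∈nbr⁺ u∈W (x∈p∩q⁺ (x∉p⇒x∈∁p c∉G , h)))) ]′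
         (x∈p∪q⁻ (cells (tops (g u))) (cells (leaves (g u))) (cells-split (g u) c∈u)))))

    R#W : Disjoint R W
    R#W x∈R x∈W = proj₁ (∈Y⁻ (W⊆Y x∈W)) x∈R

    -- Leaves account for at most three fresh cells per element of `W`, as one leaf cell lies in
    -- `G`. Whatever `R ∪ W` sees beyond that must come from A- and B-cells.
    excess : ∀ k → 4 * (∣ R ∣ + ∣ W ∣) + 2 * n + k ≤ ∣ Γ (R ∪ W) ∣ → ∣ W ∣ + k ≤ ∣ nbr E W ∣
    excess k h = +-cancelˡ-≤ (4 * ∣ R ∣ + 2 * n + 3 * ∣ W ∣) _ _ (begin
      4 * ∣ R ∣ + 2 * n + 3 * ∣ W ∣ + (∣ W ∣ + k)       ≡⟨ lemma₁ (∣ R ∣) n (∣ W ∣) k ⟩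
      4 * (∣ R ∣ + ∣ W ∣) + 2 * n + k                   ≤⟨ h ⟩
      ∣ Γ (R ∪ W) ∣                                     ≤⟨ ∣Γ∪∣≤ ⟩
      4 * ∣ R ∣ + 2 * n + (∣ nbr E W ∣ + 3 * ∣ W ∣)     ≡⟨ lemma₂ (4 * ∣ R ∣ + 2 * n) (∣ nbr E W ∣) (3 * ∣ W ∣) ⟩
      4 * ∣ R ∣ + 2 * n + 3 * ∣ W ∣ + ∣ nbr E W ∣       ∎)
      where
      lemma₁ : ∀ r n w k → 4 * r + 2 * n + 3 * w + (w + k) ≡ 4 * (r + w) + 2 * n + k
      lemma₁ = solve-∀
      lemma₂ : ∀ a b c → a + (b + c) ≡ a + c + b
      lemma₂ = solve-∀

    E-small : ∣ W ∣ < k₀ ∸ ∣ R ∣ → ∣ W ∣ ≤ ∣ nbr E W ∣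
    E-small W<c with nonempty? W
    ... | no ∅  = ≤-trans (≤-reflexive (Empty⇒∣∣≡0 ∅)) z≤n
    ... | yes ne = subst (_≤ ∣ nbr E W ∣) (+-identityʳ ∣ W ∣) (excess 0
      (≤-trans (≤-reflexive (+-identityʳ _)) (<⇒≤ (escape W R#W ne
        (≤-trans (+-monoʳ-≤ ∣ R ∣ (<⇒≤ W<c)) (≤-reflexive (m+[n∸m]≡n ∣R∣≤k₀)))))))

    -- Maximality would give only one cell more than ∣W∣. The second comes from `large`, whose
    -- `2 * n` is spent on the allowance in the bound for `G`.
    E-large : ∣ W ∣ ≡ k₀ ∸ ∣ R ∣ → 2 + ∣ W ∣ ≤ ∣ nbr E W ∣
    E-large W≡c = subst (_≤ ∣ nbr E W ∣) (+-comm ∣ W ∣ 2) (excess 2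
      (subst (λ k → 4 * k + 2 * n + 2 ≤ ∣ Γ (R ∪ W) ∣) (sym R+W≡k₀)
        (large (R ∪ W) (trans (∣∪∣-disjoint R W R#W) R+W≡k₀))))
      where
      R+W≡k₀ : ∣ R ∣ + ∣ W ∣ ≡ k₀
      R+W≡k₀ = trans (cong (∣ R ∣ +_) W≡c) (m+[n∸m]≡n ∣R∣≤k₀)

  E-hall : ∀ W → W ⊆ Y → ∣ W ∣ ≤ ∣ nbr E W ∣
  E-hall = hall-from-small E ∣E∣≤2 Y (k₀ ∸ ∣ R ∣) (m<n⇒0<n∸m ∣R∣<k₀) E-small E-large

  demand : Fin m → ℕ
  demand u = 4 * bit (lookup R u) + 1 * bit (lookup Y u)

  abstract
    N : Fin m → Subset q
    N u = if does (u ∈? R) then cells (g u) else E u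

    N-R : ∀ {u} → u ∈ R → N u ≡ cells (g u)
    N-R {u} u∈R = cong (if_then cells (g u) else E u) (dec-true (u ∈? R) u∈R)

    N-∉R : ∀ {u} → u ∉ R → N u ≡ E u
    N-∉R {u} u∉R = cong (if_then cells (g u) else E u) (dec-false (u ∈? R) u∉R)

  -- Elements of `R` compete only for cells in `G`, elements of `Y` only for cells outside it, and
  -- all others demand nothing; so the two Hall conditions add up.
  N-hall : Hall demand N
  N-hall X = begin
    weight demand X                              ≡⟨ weight-bits 4 1 R Y X ⟩
    4 * ∣ X ∩ R ∣ + 1 * ∣ X ∩ Y ∣                ≡⟨ cong (4 * ∣ X ∩ R ∣ +_) (*-identityˡ _) ⟩
    4 * ∣ X ∩ R ∣ + ∣ X ∩ Y ∣                    ≤⟨ +-mono-≤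
        (small (X ∩ R) (≤-trans (∣p∩q∣≤∣q∣ X R) ∣R∣≤k₀)) (E-hall (X ∩ Y) (p∩q⊆q X Y)) ⟩
    ∣ Γ (X ∩ R) ∣ + ∣ nbr E (X ∩ Y) ∣            ≡⟨ ∣∪∣-disjoint (Γ (X ∩ R)) (nbr E (X ∩ Y)) disjoint ⟨
    ∣ Γ (X ∩ R) ∪ nbr E (X ∩ Y) ∣                ≤⟨ p⊆q⇒∣p∣≤∣q∣ (sub ∘ x∈p∪q⁻ (Γ (X ∩ R)) (nbr E (X ∩ Y))) ⟩
    ∣ nbr N X ∣                                  ∎
    where
    disjoint : Disjoint (Γ (X ∩ R)) (nbr E (X ∩ Y))
    disjoint c∈Γ c∈E = let u , _ , c∈Eu = ∈nbr⁻ c∈E in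
      x∈∁p⇒x∉p (proj₁ (x∈p∩q⁻ (∁ G) _ c∈Eu)) (nbr-mono (p∩q⊆q X R) c∈Γ)
    sub : ∀ {c} → c ∈ Γ (X ∩ R) ⊎ c ∈ nbr E (X ∩ Y) → c ∈ nbr N X
    sub (inj₁ c∈) = let u , u∈ , c∈u = ∈nbr⁻ c∈
                        u∈X , u∈R = x∈p∩q⁻ X R u∈
                    in ∈nbr⁺ u∈X (subst (_ ∈_) (sym (N-R u∈R)) c∈u)
    sub (inj₂ c∈) = let u , u∈ , c∈u = ∈nbr⁻ c∈
                        u∈X , u∈Y = x∈p∩q⁻ X Y u∈
                    in ∈nbr⁺ u∈X (subst (_ ∈_) (sym (N-∉R (proj₁ (∈Y⁻ u∈Y)))) c∈u)

  abstract
    private-cells : Private demand N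
    private-cells = hall-private demand N N-hall

  open Private private-cells

  ∣own-R∣ : ∀ {u} → u ∈ R → 4 ≤ ∣ positions (own u) (g u) ∣
  ∣own-R∣ {u} u∈R = begin
    4                                       ≤⟨ m≤m+n 4 _ ⟩
    4 * 1 + 1 * bit (lookup Y u)            ≡⟨ cong (λ b → 4 * bit b + 1 * bit (lookup Y u)) ([]=⇒lookup u∈R) ⟨
    demand u                                ≤⟨ own-≥ u ⟩
    ∣ own u ∣                               ≤⟨ p⊆q⇒∣p∣≤∣q∣ (λ c∈ → x∈p∩q⁺ (c∈ , subst (_ ∈_) (N-R u∈R) (own-⊆ u c∈))) ⟩
    ∣ own u ∩ cells (g u) ∣                 ≤⟨ ∣∩cells∣ (own u) (g u) ⟩
    ∣ positions (own u) (g u) ∣             ∎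

  own-Y : ∀ {u} → u ∈ Y → lookup (g u) nodeA ∈ own u ⊎ lookup (g u) nodeB ∈ own u
  own-Y {u} u∈Y = find (1≤∣∣⇒Nonempty (own u) (begin
      1                                         ≤⟨ m≤n+m 1 _ ⟩
      4 * bit (lookup R u) + 1 * 1              ≡⟨ cong (λ b → 4 * bit (lookup R u) + 1 * bit b) ([]=⇒lookup u∈Y) ⟨
      demand u                                  ≤⟨ own-≥ u ⟩
      ∣ own u ∣                                 ∎))
    where
    find : Nonempty (own u) → lookup (g u) nodeA ∈ own u ⊎ lookup (g u) nodeB ∈ own u
    find (c , c∈) with ∈cells⁻ (tops (g u)) (proj₂ (x∈p∩q⁻ (∁ G) _
      (subst (c ∈_) (N-∉R (proj₁ (∈Y⁻ u∈Y))) (own-⊆ u c∈))))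
    ... | zero , refl     = inj₁ c∈
    ... | suc zero , refl = inj₂ c∈

  -- From private cells to the contents of the memory

  Respects : Memory q → Fin m → Vec Bool 6 → Set
  Respects M u w = ∀ z → lookup (g u) z ∈ own u → M z (lookup (g u) z) ≡ lookup w z

  Clean : Memory q → Set
  Clean M = ∀ z c → c ∉ G → M (suc (suc z)) c ≡ false

  -- The cells that `u` does not own are filled according to other plans, so a plan must succeed in
  -- every clean memory that agrees with it on the owned cells. The field `leaf⇒∈S` is each plan's
  -- contribution to making the memory clean.
  record Plan (u : Fin m) : Set where
    field
      bits    : Vec Bool 6
      leaf⇒∈S : ∀ z → lookup bits (suc (suc z)) ≡ true → u ∈ S
      correct : ∀ M → Respects M u bits → Clean M → read M (g u) ≡ does (u ∈? S)

  -- All four leaf bits carry the answer; the bits for A and B only have to bring the query to an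
  -- owned leaf.
  plan-R : ∀ u → u ∈ R → Plan u
  plan-R u u∈R = record
    { bits = a ∷ b ∷ replicate 4 (does (u ∈? S))
    ; leaf⇒∈S = λ z eq → does⇒ (u ∈? S) (trans (sym (lookup-replicate z _)) eq)
    ; correct = λ M ok _ → trans
        (ok _ (∈positions⁻ (g u) (steer _ _ (λ h → ok nodeA (∈positions⁻ (g u) h))
                                            (λ h → ok nodeB (∈positions⁻ (g u) h)))))
        (lookup-replicate (slot (M nodeA (lookup (g u) nodeA)) (M nodeB (lookup (g u) nodeB))) _)
    }
    where
    st = 4≤⇒steerable (positions (own u) (g u)) (∣own-R∣ u∈R)
    a = proj₁ st
    b = proj₁ (proj₂ st)
    steer = proj₂ (proj₂ st)

  plan-∉R : ∀ u → u ∉ R → (w : Vec Bool 6) → (∀ z → lookup w (suc (suc z)) ≡ false) →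
    (∀ M → Respects M u w → lookup (g u) (leafNode (M nodeA (lookup (g u) nodeA)) (M nodeB (lookup (g u) nodeB))) ∉ G) →
    Plan u
  plan-∉R u u∉R w w-leaf avoids = record
    { bits = w
    ; leaf⇒∈S = λ z eq → case trans (sym eq) (w-leaf z) of λ ()
    ; correct = λ M ok clean → trans (clean _ _ (avoids M ok)) (sym (dec-false (u ∈? S) (u∉R ∘ S⊆R)))
    }

  plan : ∀ u → Plan u
  plan u with u ∈? R | u ∈? Y
  ... | yes u∈R | _ = plan-R u u∈R
  -- No leaf of `u` lies in `G`, so every path ends at 0. Cells that `u` happens to own get zeros,
  -- which keeps the memory clean.
  ... | no u∉R | no u∉Y = plan-∉R u u∉R (replicate 6 false) (λ z → lookup-replicate z false)
    (λ M _ ∈G → u∉Y (∈Y⁺ (u∉R , _ , ∈G)))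
  ... | no u∉R | yes u∈Y with ∈Y⁻ u∈Y
  -- Only one of the cells for A and B is known to be owned. Both bits oppose the bad leaf `z`, so
  -- either alone leads to a different leaf, and that leaf lies outside `G` by `one-collision`.
  ... | _ , z , z∈G = plan-∉R u u∉R (not (rowOf z) ∷ not (colOf z) ∷ replicate 4 false)
    (λ z → lookup-replicate z false)
    (λ M ok ∈G →
      let a = M nodeA (lookup (g u) nodeA)
          b = M nodeB (lookup (g u) nodeB)
          same : z ≡ slot a b
          same = suc-injectiveᶠ (suc-injectiveᶠ (one-collision u∉R z∈G ∈G))
      in [ (λ A∈ → not-¬ (sym (trans (cong rowOf same) (rowOf-slot a b))) (ok nodeA A∈))
         , (λ B∈ → not-¬ (sym (trans (cong colOf same) (colOf-slot a b))) (ok nodeB B∈)) ]′ (own-Y u∈Y))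

  memory : Memory q
  memory z c with any? (λ u → c ∈? own u)
  ... | yes (u , _) = lookup (Plan.bits (plan u)) z
  -- `Clean` depends on this default.
  ... | no  _       = false

  memory-respects : ∀ u → Respects memory u (Plan.bits (plan u))
  memory-respects u z c∈ with any? (λ v → lookup (g u) z ∈? own v)
  ... | yes (v , c∈v) = cong (λ w → lookup (Plan.bits (plan w)) z) (own-uniq c∈v c∈)
  ... | no none       = contradiction (u , c∈) none

  -- A one at a leaf is written only for elements of `S`, and these lie in `R`, so their cells are
  -- in `G`.
  memory-clean : Clean memory
  memory-clean z c c∉G with any? (λ u → c ∈? own u)
  ... | no _ = refl
  ... | yes (u , c∈) with lookup (Plan.bits (plan u)) (suc (suc z)) in eq
  ...   | false = refl
  ...   | true  = let u∈R = S⊆R (Plan.leaf⇒∈S (plan u) z eq) in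
    contradiction (∈nbr⁺ u∈R (subst (c ∈_) (N-R u∈R) (own-⊆ u c∈))) c∉G

  memory-correct : ∀ u → read memory (g u) ≡ does (u ∈? S)
  memory-correct u = Plan.correct (plan u) memory (memory-respects u) memory-clean

scheme : ∀ {m q n k₀} (g : Fin m → Vec (Fin q) 6) → Expands n k₀ (cells ∘ g) → n ≤ k₀ →
  Scheme m n (6 * q) 3
scheme g expands n≤k₀ = (λ S hS → store (memory S hS)) , ((λ u → tree (g u)) , (λ u → depth-tree (g u))) ,
  λ S hS u → (λ eq → does⇒ (u ∈? S) (trans (sym (value S hS u)) eq)) , (λ u∈S → trans (value S hS u) (dec-true (u ∈? S) u∈S))
  where
  open Encode g expands n≤k₀ using (memory; memory-correct)
  value : ∀ S hS u → eval (tree (g u)) (store (memory S hS)) ≡ does (u ∈? S)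
  value S hS u = trans (eval-store (memory S hS) (g u)) (memory-correct S hS u)

-- Counting

∑ : List A → (A → ℕ) → ℕ
∑ []       f = 0
∑ (x ∷ xs) f = f x + ∑ xs f

∑-cong : (xs : List A) {f g : A → ℕ} → (∀ x → f x ≡ g x) → ∑ xs f ≡ ∑ xs g
∑-cong []       f≡g = refl
∑-cong (x ∷ xs) f≡g = cong₂ _+_ (f≡g x) (∑-cong xs f≡g)

∑-mono : (xs : List A) {f g : A → ℕ} → (∀ x → f x ≤ g x) → ∑ xs f ≤ ∑ xs g
∑-mono []       f≤g = z≤n
∑-mono (x ∷ xs) f≤g = +-mono-≤ (f≤g x) (∑-mono xs f≤g)

∑-+ : (xs : List A) (f g : A → ℕ) → ∑ xs (λ x → f x + g x) ≡ ∑ xs f + ∑ xs g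
∑-+ []       f g = refl
∑-+ (x ∷ xs) f g = trans (cong (f x + g x +_) (∑-+ xs f g)) (lemma (f x) (g x) (∑ xs f) (∑ xs g))
  where
  lemma : ∀ a b c d → (a + b) + (c + d) ≡ (a + c) + (b + d)
  lemma = solve-∀

∑-*ʳ : (xs : List A) (f : A → ℕ) (c : ℕ) → ∑ xs (λ x → f x * c) ≡ ∑ xs f * c
∑-*ʳ []       f c = refl
∑-*ʳ (x ∷ xs) f c = trans (cong (f x * c +_) (∑-*ʳ xs f c)) (sym (*-distribʳ-+ c (f x) (∑ xs f)))

∑-*ˡ : (xs : List A) (c : ℕ) (f : A → ℕ) → ∑ xs (λ x → c * f x) ≡ c * ∑ xs f
∑-*ˡ xs c f = trans (∑-cong xs (λ x → *-comm c (f x))) (trans (∑-*ʳ xs f c) (*-comm (∑ xs f) c))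

∑-0 : (xs : List A) → ∑ xs (const 0) ≡ 0
∑-0 []       = refl
∑-0 (_ ∷ xs) = ∑-0 xs

∑-swap : (xs : List A) (ys : List B) (f : A → B → ℕ) →
  ∑ xs (λ x → ∑ ys (f x)) ≡ ∑ ys (λ y → ∑ xs (λ x → f x y))
∑-swap []       ys f = sym (∑-0 ys)
∑-swap (x ∷ xs) ys f = trans (cong (∑ ys (f x) +_) (∑-swap xs ys f)) (sym (∑-+ ys (f x) _))

term≤∑ : {xs : List A} {x : A} (f : A → ℕ) → x ∈ᴸ xs → f x ≤ ∑ xs f
term≤∑ f (hereᴸ refl) = m≤m+n _ _
term≤∑ f (thereᴸ x∈)  = ≤-trans (term≤∑ f x∈) (m≤n+m _ _)

-- The first moment method: natural numbers with average below one include a zero.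
∃-zero : (xs : List A) (f : A → ℕ) → ∑ xs f < ∑ xs (const 1) → ∃ λ x → f x ≡ 0
∃-zero (x ∷ xs) f lt with f x in eq
... | zero  = x , eq
... | suc k = ∃-zero xs f (≤-trans (s≤s (m≤n+m (∑ xs f) k)) (s≤s⁻¹ lt))

∑-++ : (xs ys : List A) (f : A → ℕ) → ∑ (xs ++ ys) f ≡ ∑ xs f + ∑ ys f
∑-++ []       ys f = refl
∑-++ (x ∷ xs) ys f = trans (cong (f x +_) (∑-++ xs ys f)) (sym (+-assoc (f x) _ _))

∑-map : (h : A → B) (xs : List A) (f : B → ℕ) → ∑ (mapᴸ h xs) f ≡ ∑ xs (f ∘ h)
∑-map h []       f = refl
∑-map h (x ∷ xs) f = cong (f (h x) +_) (∑-map h xs f)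

vecs : List A → ∀ m → List (Vec A m)
vecs xs zero    = [] ∷ []
vecs xs (suc m) = cartesianProductWith _∷_ xs (vecs xs m)

∈-vecs : {xs : List A} → (∀ x → x ∈ᴸ xs) → (v : Vec A m) → v ∈ᴸ vecs xs m
∈-vecs all []      = hereᴸ refl
∈-vecs all (x ∷ v) = ∈-cartesianProductWith⁺ _∷_ (all x) (∈-vecs all v)

∑-vecs-suc : (xs : List A) (f : Vec A (suc m) → ℕ) →
  ∑ (vecs xs (suc m)) f ≡ ∑ xs (λ x → ∑ (vecs xs m) (λ v → f (x ∷ v)))
∑-vecs-suc {m = m} xs f = go xs
  where
  go : ∀ ys → ∑ (cartesianProductWith _∷_ ys (vecs xs m)) f ≡ ∑ ys (λ x → ∑ (vecs xs m) (λ v → f (x ∷ v)))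
  go []       = refl
  go (y ∷ ys) = trans (∑-++ (mapᴸ (y ∷_) (vecs xs m)) _ f)
    (cong₂ _+_ (∑-map (y ∷_) (vecs xs m) f) (go ys))

∏ : (A → ℕ) → Vec A m → ℕ
∏ f []      = 1
∏ f (x ∷ v) = f x * ∏ f v

∑-∏ : (xs : List A) (f : A → ℕ) → ∀ m → ∑ (vecs xs m) (∏ f) ≡ ∑ xs f ^ m
∑-∏ xs f zero    = refl
∑-∏ xs f (suc m) = begin
  ∑ (vecs xs (suc m)) (∏ f)                              ≡⟨ ∑-vecs-suc xs (∏ f) ⟩
  ∑ xs (λ x → ∑ (vecs xs m) (λ v → f x * ∏ f v))         ≡⟨ ∑-cong xs (λ x → ∑-*ˡ (vecs xs m) (f x) (∏ f)) ⟩
  ∑ xs (λ x → f x * ∑ (vecs xs m) (∏ f))                 ≡⟨ ∑-*ʳ xs f _ ⟩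
  ∑ xs f * ∑ (vecs xs m) (∏ f)                           ≡⟨ cong (∑ xs f *_) (∑-∏ xs f m) ⟩
  ∑ xs f * ∑ xs f ^ m                                    ∎
  where open ≡-Reasoning

∑-tabulate-bit : (h : Fin q → A) (f : A → ℕ) (V : Subset q) → (∀ i → f (h i) ≡ bit (lookup V i)) →
  ∑ (tabulateᴸ h) f ≡ ∣ V ∣
∑-tabulate-bit h f []          eq = refl
∑-tabulate-bit h f (true  ∷ V) eq = cong₂ _+_ (eq zero) (∑-tabulate-bit (h ∘ suc) f V (eq ∘ suc))
∑-tabulate-bit h f (false ∷ V) eq = cong₂ _+_ (eq zero) (∑-tabulate-bit (h ∘ suc) f V (eq ∘ suc))

∑-allFin-1 : ∀ q → ∑ (allFin q) (const 1) ≡ q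
∑-allFin-1 q = go (λ i → i)
  where
  go : ∀ {q} {A : Set} (h : Fin q → A) → ∑ (tabulateᴸ h) (const 1) ≡ q
  go {zero}  h = refl
  go {suc q} h = cong suc (go (h ∘ suc))

∑-1 : (xs : List A) → ∀ m → ∑ (vecs xs m) (const 1) ≡ ∑ xs (const 1) ^ m
∑-1 {A} xs m = trans (∑-cong (vecs xs m) (sym ∘ ∏-1)) (∑-∏ xs (const 1) m)
  where
  ∏-1 : ∀ {m} (v : Vec A m) → ∏ (const 1) v ≡ 1
  ∏-1 []      = refl
  ∏-1 (_ ∷ v) = trans (+-identityʳ _) (∏-1 v)

bit-≤ : ∀ {P : Set} {x y} (P? : Dec P) → (P → x ≤ y) → bit (does P?) * x ≤ y
bit-≤ (yes p) x≤y = ≤-trans (≤-reflexive (+-identityʳ _)) (x≤y p)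
bit-≤ (no _)  x≤y = z≤n

bit-mono : ∀ {P P′ : Set} {x y} (P? : Dec P) (P′? : Dec P′) → (P → P′) → (P → x ≤ y) →
  bit (does P?) * x ≤ bit (does P′?) * y
bit-mono (no _)  P′?      _    _   = z≤n
bit-mono (yes p) (yes _)  _    x≤y = *-monoʳ-≤ 1 (x≤y p)
bit-mono (yes p) (no ¬p′) P→P′ _   = contradiction (P→P′ p) ¬p′

-- The number of subsets of bounded size

subsets : ∀ m → List (Subset m)
subsets = vecs (true ∷ false ∷ [])

∈-subsets : (X : Subset m) → X ∈ᴸ subsets m
∈-subsets = ∈-vecs λ { true → hereᴸ refl ; false → thereᴸ (hereᴸ refl) }

count≤ : ℕ → ℕ → ℕ
count≤ n a = ∑ (subsets n) (λ V → bit (does (∣ V ∣ ≤? a)))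

weighted : ℕ → ℕ → Bool → ℕ
weighted x y b = if b then x else y

∏-weighted-≥ : ∀ {x y} → x ≤ y → (V : Subset n) → ∀ a → ∣ V ∣ ≤ a →
  x ^ a * y ^ n ≤ ∏ (weighted x y) V * y ^ a
∏-weighted-≥ {x = x} {y} x≤y [] a _ = begin
  x ^ a * 1   ≡⟨ *-comm (x ^ a) 1 ⟩
  1 * x ^ a   ≤⟨ *-monoʳ-≤ 1 (^-monoˡ-≤ a x≤y) ⟩
  1 * y ^ a   ∎
  where open ≤-Reasoning
∏-weighted-≥ {n = suc n} {x} {y} x≤y (true ∷ V) (suc a) (s≤s V≤a) = begin
  (x * x ^ a) * (y * y ^ n)                      ≡⟨ lemma x (x ^ a) y (y ^ n) ⟩
  (x * y) * (x ^ a * y ^ n)                      ≤⟨ *-monoʳ-≤ (x * y) (∏-weighted-≥ x≤y V a V≤a) ⟩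
  (x * y) * (∏ (weighted x y) V * y ^ a)         ≡⟨ lemma x (∏ (weighted x y) V) y (y ^ a) ⟨
  (x * ∏ (weighted x y) V) * (y * y ^ a)         ∎
  where
  open ≤-Reasoning
  lemma : ∀ x a y b → (x * a) * (y * b) ≡ (x * y) * (a * b)
  lemma = solve-∀
∏-weighted-≥ {n = suc n} {x} {y} x≤y (false ∷ V) a V≤a = begin
  x ^ a * (y * y ^ n)                      ≡⟨ lemma (x ^ a) y (y ^ n) ⟩
  y * (x ^ a * y ^ n)                      ≤⟨ *-monoʳ-≤ y (∏-weighted-≥ x≤y V a V≤a) ⟩
  y * (∏ (weighted x y) V * y ^ a)         ≡⟨ *-assoc y _ (y ^ a) ⟨
  y * ∏ (weighted x y) V * y ^ a           ∎
  where
  open ≤-Reasoning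
  lemma : ∀ a y b → a * (y * b) ≡ y * (a * b)
  lemma = solve-∀

-- The sum of x^|V| y^(n-|V|) over all V is (x + y)^n, and each V with |V| ≤ a contributes at least
-- x^a y^(n-a); both sides are multiplied by y^a to avoid the subtraction.
count≤-weighted : ∀ {x y} → x ≤ y → ∀ n a → count≤ n a * (x ^ a * y ^ n) ≤ (x + y) ^ n * y ^ a
count≤-weighted {x} {y} x≤y n a = begin
  count≤ n a * (x ^ a * y ^ n)
    ≡⟨ ∑-*ʳ (subsets n) _ _ ⟨
  ∑ (subsets n) (λ V → bit (does (∣ V ∣ ≤? a)) * (x ^ a * y ^ n))
    ≤⟨ ∑-mono (subsets n) bound ⟩
  ∑ (subsets n) (λ V → ∏ (weighted x y) V * y ^ a)
    ≡⟨ ∑-*ʳ (subsets n) _ _ ⟩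
  ∑ (subsets n) (∏ (weighted x y)) * y ^ a
    ≡⟨ cong (_* y ^ a) (∑-∏ _ (weighted x y) n) ⟩
  (x + (y + 0)) ^ n * y ^ a
    ≡⟨ cong (λ k → (x + k) ^ n * y ^ a) (+-identityʳ y) ⟩
  (x + y) ^ n * y ^ a ∎
  where
  open ≤-Reasoning
  bound : ∀ V → bit (does (∣ V ∣ ≤? a)) * (x ^ a * y ^ n) ≤ ∏ (weighted x y) V * y ^ a
  bound V = bit-≤ (∣ V ∣ ≤? a) (∏-weighted-≥ x≤y V a)

-- (1 + 1/a)^i ≤ a / (a - i) for a = i + j, cleared of denominators
[1+a]^i*j≤a^i*a : ∀ i j → suc (i + j) ^ i * j ≤ (i + j) ^ i * (i + j)
[1+a]^i*j≤a^i*a zero    j = ≤-refl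
[1+a]^i*j≤a^i*a (suc i) j = *-cancelʳ-≤ _ _ (suc j) (begin
  (suc a * suc a ^ i) * j * suc j          ≡⟨ lemma₁ (suc a) (suc a ^ i) j (suc j) ⟩
  (suc a * j) * (suc a ^ i * suc j)        ≤⟨ *-mono-≤ (+-monoˡ-≤ (a * j) (≤-trans (m≤n+m j i) (n≤1+n _))) ih ⟩
  (a + a * j) * (a ^ i * a)                ≡⟨ cong (_* (a ^ i * a)) (*-suc a j) ⟨
  (a * suc j) * (a ^ i * a)                ≡⟨ lemma₂ a (a ^ i) (suc j) ⟩
  a * a ^ i * a * suc j                    ∎)
  where
  open ≤-Reasoning
  a = suc (i + j)
  ih : suc a ^ i * suc j ≤ a ^ i * a
  ih = subst (λ a → suc a ^ i * suc j ≤ a ^ i * a) (+-suc i j) ([1+a]^i*j≤a^i*a i (suc j))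
  lemma₁ : ∀ s p j t → (s * p) * j * t ≡ (s * j) * (p * t)
  lemma₁ = solve-∀
  lemma₂ : ∀ a p t → (a * t) * (p * a) ≡ a * p * a * t
  lemma₂ = solve-∀

[1+a]^i≤2a^i : ∀ i j .{{_ : NonZero j}} → i ≤ j → suc (i + j) ^ i ≤ 2 * (i + j) ^ i
[1+a]^i≤2a^i i j i≤j = *-cancelʳ-≤ _ _ j (begin
  suc (i + j) ^ i * j        ≤⟨ [1+a]^i*j≤a^i*a i j ⟩
  (i + j) ^ i * (i + j)      ≤⟨ *-monoʳ-≤ ((i + j) ^ i) (+-monoˡ-≤ j i≤j) ⟩
  (i + j) ^ i * (j + j)      ≡⟨ lemma ((i + j) ^ i) j ⟩
  2 * (i + j) ^ i * j        ∎)
  where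
  open ≤-Reasoning
  lemma : ∀ p j → p * (j + j) ≡ 2 * p * j
  lemma = solve-∀

-- A substitute for (1 + 1/a)^a ≤ e. Half of the exponent contributes a factor 2; the other half may
-- be longer by one and contributes at most 4.
[1+a]^a≤8a^a : ∀ a → suc a ^ a ≤ 8 * a ^ a
[1+a]^a≤8a^a zero = s≤s z≤n
[1+a]^a≤8a^a a@(suc b) = begin
  suc a ^ a                        ≡⟨ cong (suc a ^_) i+j≡a ⟨
  suc a ^ (i + j)                  ≡⟨ ^-distribˡ-+-* (suc a) i j ⟩
  suc a ^ i * suc a ^ j            ≤⟨ *-mono-≤ half other-half ⟩
  (2 * a ^ i) * (4 * a ^ j)        ≡⟨ lemma (a ^ i) (a ^ j) ⟩
  8 * (a ^ i * a ^ j)              ≡⟨ cong (8 *_) (^-distribˡ-+-* a i j) ⟨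
  8 * a ^ (i + j)                  ≡⟨ cong (λ k → 8 * a ^ k) i+j≡a ⟩
  8 * a ^ a                        ∎
  where
  open ≤-Reasoning
  i = ⌊ a /2⌋
  j = ⌈ a /2⌉
  i+j≡a : i + j ≡ a
  i+j≡a = ⌊n/2⌋+⌈n/2⌉≡n a
  lemma : ∀ p r → (2 * p) * (4 * r) ≡ 8 * (p * r)
  lemma = solve-∀
  half : suc a ^ i ≤ 2 * a ^ i
  half = subst (λ a → suc a ^ i ≤ 2 * a ^ i) i+j≡a ([1+a]^i≤2a^i i j (⌊n/2⌋≤⌈n/2⌉ a))
  suc-half : suc a ^ suc i ≤ 4 * a ^ suc i
  suc-half = begin
    suc a * suc a ^ i        ≤⟨ *-mono-≤ (+-monoˡ-≤ a {1} {a} (s≤s z≤n)) half ⟩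
    (a + a) * (2 * a ^ i)    ≡⟨ lemma′ a (a ^ i) ⟩
    4 * (a * a ^ i)          ∎
    where
    lemma′ : ∀ a p → (a + a) * (2 * p) ≡ 4 * (a * p)
    lemma′ = solve-∀
  other-half : suc a ^ j ≤ 4 * a ^ j
  other-half with m≤n⇒m<n∨m≡n (⌊n/2⌋-mono (n≤1+n (suc a)))
  ... | inj₁ j<1+i = subst (λ k → suc a ^ k ≤ 4 * a ^ k) (≤-antisym (⌊n/2⌋≤⌈n/2⌉ a) (s≤s⁻¹ j<1+i))
                       (≤-trans half (*-monoˡ-≤ (a ^ i) {2} {4} (s≤s (s≤s z≤n))))
  ... | inj₂ j≡1+i = subst (λ k → suc a ^ k ≤ 4 * a ^ k) (sym j≡1+i) suc-half

[1+a]^q≤8a^q : ∀ {q a} .{{_ : NonZero a}} → q ≤ a → suc a ^ q ≤ 8 * a ^ q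
[1+a]^q≤8a^q {q} {a} q≤a = *-cancelʳ-≤ _ _ (suc a ^ d) {{m^n≢0 (suc a) d}} (begin
  suc a ^ q * suc a ^ d      ≡⟨ ^-distribˡ-+-* (suc a) q d ⟨
  suc a ^ (q + d)            ≡⟨ cong (suc a ^_) q+d≡a ⟩
  suc a ^ a                  ≤⟨ [1+a]^a≤8a^a a ⟩
  8 * a ^ a                  ≡⟨ cong (λ k → 8 * a ^ k) q+d≡a ⟨
  8 * a ^ (q + d)            ≡⟨ cong (8 *_) (^-distribˡ-+-* a q d) ⟩
  8 * (a ^ q * a ^ d)        ≤⟨ *-monoʳ-≤ 8 (*-monoʳ-≤ (a ^ q) (^-monoˡ-≤ d (n≤1+n a))) ⟩
  8 * (a ^ q * suc a ^ d)    ≡⟨ *-assoc 8 (a ^ q) _ ⟨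
  8 * a ^ q * suc a ^ d      ∎)
  where
  open ≤-Reasoning
  d = a ∸ q
  q+d≡a : q + d ≡ a
  q+d≡a = m+[n∸m]≡n q≤a

-- The role of (1 + v/q)^q ≤ e^v: the quotient telescopes into `v` factors (1 + 1/a)^q with a ≥ q,
-- each at most 8.
[v+q]^q≤8^v*q^q : ∀ v q .{{_ : NonZero q}} → (v + q) ^ q ≤ 8 ^ v * q ^ q
[v+q]^q≤8^v*q^q zero    q = ≤-reflexive (sym (*-identityˡ _))
[v+q]^q≤8^v*q^q (suc v) q = begin
  suc (v + q) ^ q        ≤⟨ [1+a]^q≤8a^q {{v+q≢0}} (m≤n+m q v) ⟩
  8 * (v + q) ^ q        ≤⟨ *-monoʳ-≤ 8 ([v+q]^q≤8^v*q^q v q) ⟩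
  8 * (8 ^ v * q ^ q)    ≡⟨ *-assoc 8 (8 ^ v) _ ⟨
  8 * 8 ^ v * q ^ q      ∎
  where
  open ≤-Reasoning
  v+q≢0 : NonZero (v + q)
  v+q≢0 = >-nonZero (≤-trans (>-nonZero⁻¹ q) (m≤n+m q v))

^-distribʳ-* : ∀ k m n → (m * n) ^ k ≡ m ^ k * n ^ k
^-distribʳ-* zero    m n = refl
^-distribʳ-* (suc k) m n = trans (cong (m * n *_) (^-distribʳ-* k m n)) (lemma m n (m ^ k) (n ^ k))
  where
  lemma : ∀ m n a b → m * n * (a * b) ≡ (m * a) * (n * b)
  lemma = solve-∀

-- The familiar estimate (eq/v)^v for the number of subsets of size at most v, with 8 for e; the
-- weights `x` = v and `y` = q are the optimal ones up to constants.
count≤-bound : ∀ {v q} .{{_ : NonZero q}} → v ≤ q → count≤ q v * v ^ v ≤ (8 * q) ^ v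
count≤-bound {v} {q} v≤q = *-cancelʳ-≤ _ _ (q ^ q) {{m^n≢0 q q}} (begin
  count≤ q v * v ^ v * q ^ q          ≡⟨ *-assoc (count≤ q v) _ _ ⟩
  count≤ q v * (v ^ v * q ^ q)        ≤⟨ count≤-weighted v≤q q v ⟩
  (v + q) ^ q * q ^ v                 ≤⟨ *-monoˡ-≤ (q ^ v) ([v+q]^q≤8^v*q^q v q) ⟩
  8 ^ v * q ^ q * q ^ v               ≡⟨ lemma (8 ^ v) (q ^ q) (q ^ v) ⟩
  (8 ^ v * q ^ v) * q ^ q             ≡⟨ cong (_* q ^ q) (^-distribʳ-* v 8 q) ⟨
  (8 * q) ^ v * q ^ q                 ∎)
  where
  open ≤-Reasoning
  lemma : ∀ a b c → a * b * c ≡ (a * c) * b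
  lemma = solve-∀

-- Random graphs and sets that see too few cells

Graph : ℕ → ℕ → Set
Graph m q = Vec (Vec (Fin q) 6) m

choices : ∀ q → List (Vec (Fin q) 6)
choices q = vecs (allFin q) 6

graphs : ∀ m q → List (Graph m q)
graphs m q = vecs (choices q) m

∣choices∣ : ∀ q → ∑ (choices q) (const 1) ≡ q ^ 6
∣choices∣ q = trans (∑-1 (allFin q) 6) (cong (_^ 6) (∑-allFin-1 q))

∣graphs∣ : ∀ m q → ∑ (graphs m q) (const 1) ≡ (q ^ 6) ^ m
∣graphs∣ m q = trans (∑-1 (choices q) m) (cong (_^ m) (∣choices∣ q))

module _ (V : Subset q) where

  covers : Vec (Fin q) 6 → ℕ
  covers = ∏ (bit ∘ lookup V)

  -- The indicator that all cells of all elements of `R` lie in `V`; being a product over elements,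
  -- it can be summed one element at a time.
  covered : Graph m q → Subset m → ℕ
  covered []      []          = 1
  covered (x ∷ g) (true  ∷ R) = covers x * covered g R
  covered (x ∷ g) (false ∷ R) = covered g R

  ∑-covers : ∑ (choices q) covers ≡ ∣ V ∣ ^ 6
  ∑-covers = trans (∑-∏ (allFin q) (bit ∘ lookup V) 6)
    (cong (_^ 6) (∑-tabulate-bit (λ i → i) (bit ∘ lookup V) V (λ _ → refl)))

  -- The probability of seeing only `V` is (∣V∣/q)^(6∣R∣), by independence; denominators are
  -- cleared.
  ∑-covered : (R : Subset m) →
    ∑ (graphs m q) (λ g → covered g R) * (q ^ 6) ^ ∣ R ∣ ≡ (∣ V ∣ ^ 6) ^ ∣ R ∣ * (q ^ 6) ^ m
  ∑-covered [] = refl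
  ∑-covered {suc m} (true ∷ R) = begin
    ∑ (graphs (suc m) q) (λ g → covered g (true ∷ R)) * (Q * Q ^ ∣ R ∣)
      ≡⟨ cong (_* (Q * Q ^ ∣ R ∣)) (∑-vecs-suc (choices q) (λ g → covered g (true ∷ R))) ⟩
    ∑ (choices q) (λ x → ∑ (graphs m q) (λ g → covers x * covered g R)) * (Q * Q ^ ∣ R ∣)
      ≡⟨ cong (_* (Q * Q ^ ∣ R ∣)) (trans (∑-cong (choices q) (λ x → ∑-*ˡ (graphs m q) (covers x) (λ g → covered g R)))
           (trans (∑-*ʳ (choices q) covers _) (cong (_* T) ∑-covers))) ⟩
    ∣ V ∣ ^ 6 * T * (Q * Q ^ ∣ R ∣)
      ≡⟨ lemma (∣ V ∣ ^ 6) T Q (Q ^ ∣ R ∣) ⟩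
    ∣ V ∣ ^ 6 * Q * (T * Q ^ ∣ R ∣)
      ≡⟨ cong (∣ V ∣ ^ 6 * Q *_) (∑-covered R) ⟩
    ∣ V ∣ ^ 6 * Q * ((∣ V ∣ ^ 6) ^ ∣ R ∣ * Q ^ m)
      ≡⟨ lemma (∣ V ∣ ^ 6) ((∣ V ∣ ^ 6) ^ ∣ R ∣) Q (Q ^ m) ⟨
    ∣ V ∣ ^ 6 * (∣ V ∣ ^ 6) ^ ∣ R ∣ * (Q * Q ^ m) ∎
    where
    open ≡-Reasoning
    Q = q ^ 6
    T = ∑ (graphs m q) (λ g → covered g R)
    lemma : ∀ v t q r → v * t * (q * r) ≡ v * q * (t * r)
    lemma = solve-∀
  ∑-covered {suc m} (false ∷ R) = begin
    ∑ (graphs (suc m) q) (λ g → covered g (false ∷ R)) * Q ^ ∣ R ∣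
      ≡⟨ cong (_* Q ^ ∣ R ∣) (∑-vecs-suc (choices q) (λ g → covered g (false ∷ R))) ⟩
    ∑ (choices q) (const T) * Q ^ ∣ R ∣
      ≡⟨ cong (_* Q ^ ∣ R ∣) (trans (∑-cong (choices q) (λ _ → sym (*-identityˡ T)))
           (trans (∑-*ʳ (choices q) (const 1) T) (cong (_* T) (∣choices∣ q)))) ⟩
    Q * T * Q ^ ∣ R ∣
      ≡⟨ *-assoc Q T _ ⟩
    Q * (T * Q ^ ∣ R ∣)
      ≡⟨ cong (Q *_) (∑-covered R) ⟩
    Q * ((∣ V ∣ ^ 6) ^ ∣ R ∣ * Q ^ m)
      ≡⟨ lemma Q ((∣ V ∣ ^ 6) ^ ∣ R ∣) (Q ^ m) ⟩
    (∣ V ∣ ^ 6) ^ ∣ R ∣ * (Q * Q ^ m) ∎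
    where
    open ≡-Reasoning
    Q = q ^ 6
    T = ∑ (graphs m q) (λ g → covered g R)
    lemma : ∀ a b c → a * (b * c) ≡ b * (a * c)
    lemma = solve-∀

  covered-≥1 : (g : Graph m q) (R : Subset m) →
    (∀ {u} z → u ∈ R → lookup (lookup g u) z ∈ V) → 1 ≤ covered g R
  covered-≥1 [] [] _ = ≤-refl
  covered-≥1 (x ∷ g) (false ∷ R) in-V = covered-≥1 g R (λ z u∈R → in-V z (there u∈R))
  covered-≥1 (x ∷ g) (true ∷ R) in-V = *-mono-≤ {1} {covers x} {1}
    (∏-≥1 x (λ z → in-V z here)) (covered-≥1 g R (λ z u∈R → in-V z (there u∈R)))
    where
    ∏-≥1 : ∀ {n} (x : Vec (Fin q) n) → (∀ z → lookup x z ∈ V) → 1 ≤ ∏ (bit ∘ lookup V) x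
    ∏-≥1 []      _    = ≤-refl
    ∏-≥1 (c ∷ x) in-V = *-mono-≤ {1} {bit (lookup V c)} {1}
      (≤-reflexive (cong bit (sym ([]=⇒lookup (in-V zero))))) (∏-≥1 x (in-V ∘ suc))

module _ (m q k v : ℕ) where

  -- Seeing at most `v` cells is not an event of product form. Fixing a set `V` that contains the
  -- cells makes it one, at the price of a sum over `V`.
  violations : Graph m q → ℕ
  violations g = ∑ (subsets m) λ R → ∑ (subsets q) λ V →
    bit (does (∣ R ∣ ≟ k)) * (bit (does (∣ V ∣ ≤? v)) * covered V g R)

  no-violation : ∀ g → violations g ≡ 0 → ∀ R → ∣ R ∣ ≡ k → v < ∣ nbr (cells ∘ lookup g) R ∣
  no-violation g none R R≡k = ≰⇒> λ Γ≤v → contradiction (begin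
    1                              ≤⟨ covered-≥1 Γ g R (λ {u} z u∈R → ∈nbr⁺ u∈R (∈cells⁺ (lookup g u) z)) ⟩
    covered Γ g R                  ≡⟨ lemma (covered Γ g R) ⟨
    1 * (1 * covered Γ g R)        ≡⟨ cong₂ (λ a b → bit a * (bit b * covered Γ g R))
                                        (dec-true (∣ R ∣ ≟ k) R≡k) (dec-true (∣ Γ ∣ ≤? v) Γ≤v) ⟨
    f R Γ                          ≤⟨ term≤∑ (f R) (∈-subsets Γ) ⟩
    ∑ (subsets q) (f R)            ≤⟨ term≤∑ (λ R → ∑ (subsets q) (f R)) (∈-subsets R) ⟩
    violations g                   ≡⟨ none ⟩
    0                              ∎) λ ()
    where
    open ≤-Reasoning
    Γ = nbr (cells ∘ lookup g) R
    f : Subset m → Subset q → ℕ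
    f R V = bit (does (∣ R ∣ ≟ k)) * (bit (does (∣ V ∣ ≤? v)) * covered V g R)
    lemma : ∀ x → 1 * (1 * x) ≡ x
    lemma = solve-∀

  -- The union bound: number of `R`, times number of `V`, times (v/q)^(6k). Size exactly `k` is
  -- relaxed to at most `k` so that `count≤` serves for both.
  ∑-violations : ∑ (graphs m q) violations * (q ^ 6) ^ k ≤
    count≤ m k * count≤ q v * (v ^ 6) ^ k * (q ^ 6) ^ m
  ∑-violations = begin
    ∑ (graphs m q) violations * Q ^ k
      ≡⟨ cong (_* Q ^ k) (trans (∑-swap (graphs m q) (subsets m) _) (∑-cong (subsets m) (λ R → ∑-swap (graphs m q) (subsets q) _))) ⟩
    ∑ (subsets m) (λ R → ∑ (subsets q) λ V → ∑ (graphs m q) λ g → r R * (s V * covered V g R)) * Q ^ k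
      ≡⟨ trans (sym (∑-*ʳ (subsets m) _ _)) (∑-cong (subsets m) (λ R → sym (∑-*ʳ (subsets q) _ _))) ⟩
    ∑ (subsets m) (λ R → ∑ (subsets q) λ V → ∑ (graphs m q) (λ g → r R * (s V * covered V g R)) * Q ^ k)
      ≤⟨ ∑-mono (subsets m) (λ R → ∑-mono (subsets q) (bound R)) ⟩
    ∑ (subsets m) (λ R → ∑ (subsets q) λ V → r′ R * (s V * C))
      ≡⟨ ∑-cong (subsets m) (λ R → trans (∑-*ˡ (subsets q) (r′ R) _) (cong (r′ R *_) (∑-*ʳ (subsets q) s C))) ⟩
    ∑ (subsets m) (λ R → r′ R * (count≤ q v * C))
      ≡⟨ ∑-*ʳ (subsets m) r′ _ ⟩
    count≤ m k * (count≤ q v * C)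
      ≡⟨ lemma (count≤ m k) (count≤ q v) ((v ^ 6) ^ k) (Q ^ m) ⟩
    count≤ m k * count≤ q v * (v ^ 6) ^ k * Q ^ m ∎
    where
    open ≤-Reasoning
    Q = q ^ 6
    C = (v ^ 6) ^ k * Q ^ m
    r r′ : Subset m → ℕ
    r  R = bit (does (∣ R ∣ ≟ k))
    r′ R = bit (does (∣ R ∣ ≤? k))
    s : Subset q → ℕ
    s V = bit (does (∣ V ∣ ≤? v))
    lemma : ∀ a b c d → a * (b * (c * d)) ≡ a * b * c * d
    lemma = solve-∀
    lemma′ : ∀ r s t x → r * (s * t) * x ≡ r * (s * (t * x))
    lemma′ = solve-∀
    bound : ∀ R V → ∑ (graphs m q) (λ g → r R * (s V * covered V g R)) * Q ^ k ≤ r′ R * (s V * C)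
    bound R V = begin
      ∑ (graphs m q) (λ g → r R * (s V * covered V g R)) * Q ^ k
        ≡⟨ cong (_* Q ^ k) (trans (∑-*ˡ (graphs m q) (r R) _) (cong (r R *_) (∑-*ˡ (graphs m q) (s V) _))) ⟩
      r R * (s V * ∑ (graphs m q) (λ g → covered V g R)) * Q ^ k
        ≡⟨ lemma′ (r R) (s V) _ (Q ^ k) ⟩
      r R * (s V * (∑ (graphs m q) (λ g → covered V g R) * Q ^ k))
        ≤⟨ bit-mono (∣ R ∣ ≟ k) (∣ R ∣ ≤? k) ≤-reflexive (λ { refl →
             bit-mono (∣ V ∣ ≤? v) (∣ V ∣ ≤? v) (λ V≤v → V≤v) (λ V≤v →
               ≤-trans (≤-reflexive (∑-covered V R))
                 (*-monoˡ-≤ (Q ^ m) (^-monoˡ-≤ ∣ R ∣ (^-monoˡ-≤ 6 V≤v)))) }) ⟩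
      r′ R * (s V * C) ∎

-- c collects the constant factors of the union bound: 16 per element and 8 for each of its 6 nodes.
-- Abstract, since unrolling multiplication by c would be infeasible.
private abstract
  c : ℕ
  c = 16 * 8 ^ 6

  c-def : c ≡ 16 * 8 ^ 6
  c-def = refl

  36≤c : 36 ≤ c
  36≤c = ≤ᵇ⇒≤ 36 c _

  -- Since `c` is 2^22, the constant 8c in the upper bound for q² is exactly 2^25.
  h : ℕ
  h = 25

  8c≤2^h : 4 * (2 * c) ≤ 2 ^ h
  8c≤2^h = ≤ᵇ⇒≤ (4 * (2 * c)) (2 ^ h) _

c^k≡ : ∀ k → c ^ k ≡ 16 ^ k * 8 ^ (6 * k)
c^k≡ k = begin
  c ^ k                    ≡⟨ cong (_^ k) c-def ⟩
  (16 * 8 ^ 6) ^ k         ≡⟨ ^-distribʳ-* k 16 (8 ^ 6) ⟩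
  16 ^ k * (8 ^ 6) ^ k     ≡⟨ cong (16 ^ k *_) (^-*-assoc 8 6 k) ⟩
  16 ^ k * 8 ^ (6 * k)     ∎
  where open ≡-Reasoning

-- The event that some k elements see at most v = 4k + e cells; f completes e to 2k.
module Failure (m q k e f : ℕ) .{{_ : NonZero m}} .{{_ : NonZero q}} .{{_ : NonZero k}}
  (e+f≡2k : e + f ≡ k + k) (k≤m : k ≤ m) (v≤q : 4 * k + e ≤ q)
  (q^e≤ : q ^ e ≤ 2 ^ k * k ^ e) (cmk≤q² : 2 * (c * (m * k)) ≤ q * q) where

  open ≤-Reasoning

  v : ℕ
  v = 4 * k + e

  v+f≡6k : v + f ≡ 6 * k
  v+f≡6k = trans (+-assoc (4 * k) e f) (trans (cong (4 * k +_) e+f≡2k) (lemma k))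
    where
    lemma : ∀ k → 4 * k + (k + k) ≡ 6 * k
    lemma = solve-∀

  v≤8k : v ≤ 8 * k
  v≤8k = begin
    v        ≤⟨ m≤m+n v f ⟩
    v + f    ≡⟨ v+f≡6k ⟩
    6 * k    ≤⟨ *-monoˡ-≤ k (m≤m+n 6 2) ⟩
    8 * k    ∎

  -- The k-th power of `cmk≤q²`; its factor 2 becomes the 2^k that pays for the slack (q/k)^e.
  mk-bound : c ^ k * m ^ k * k ^ k ≤ k ^ e * q ^ f
  mk-bound = *-cancelˡ-≤ (2 ^ k) {{m^n≢0 2 k}} (begin
    2 ^ k * (c ^ k * m ^ k * k ^ k)      ≡⟨ cong (2 ^ k *_) (*-assoc (c ^ k) _ _) ⟩
    2 ^ k * (c ^ k * (m ^ k * k ^ k))    ≡⟨ cong (λ x → 2 ^ k * (c ^ k * x)) (^-distribʳ-* k m k) ⟨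
    2 ^ k * (c ^ k * (m * k) ^ k)        ≡⟨ cong (2 ^ k *_) (^-distribʳ-* k c (m * k)) ⟨
    2 ^ k * (c * (m * k)) ^ k            ≡⟨ ^-distribʳ-* k 2 (c * (m * k)) ⟨
    (2 * (c * (m * k))) ^ k              ≤⟨ ^-monoˡ-≤ k cmk≤q² ⟩
    (q * q) ^ k                          ≡⟨ ^-distribʳ-* k q q ⟩
    q ^ k * q ^ k                        ≡⟨ ^-distribˡ-+-* q k k ⟨
    q ^ (k + k)                          ≡⟨ cong (q ^_) e+f≡2k ⟨
    q ^ (e + f)                          ≡⟨ ^-distribˡ-+-* q e f ⟩
    q ^ e * q ^ f                        ≤⟨ *-monoˡ-≤ (q ^ f) q^e≤ ⟩
    2 ^ k * k ^ e * q ^ f                ≡⟨ *-assoc (2 ^ k) _ _ ⟩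
    2 ^ k * (k ^ e * q ^ f)              ∎)

  mk^f-bound : c ^ k * m ^ k * k ^ f ≤ q ^ f * k ^ k
  mk^f-bound = *-cancelʳ-≤ _ _ (k ^ k) {{m^n≢0 k k}} (begin
    c ^ k * m ^ k * k ^ f * k ^ k        ≡⟨ lemma (c ^ k * m ^ k) (k ^ f) (k ^ k) ⟩
    c ^ k * m ^ k * k ^ k * k ^ f        ≤⟨ *-monoˡ-≤ (k ^ f) mk-bound ⟩
    k ^ e * q ^ f * k ^ f                ≡⟨ lemma′ (k ^ e) (q ^ f) (k ^ f) ⟩
    q ^ f * (k ^ e * k ^ f)              ≡⟨ cong (q ^ f *_) (^-distribˡ-+-* k e f) ⟨
    q ^ f * k ^ (e + f)                  ≡⟨ cong (λ x → q ^ f * k ^ x) e+f≡2k ⟩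
    q ^ f * k ^ (k + k)                  ≡⟨ cong (q ^ f *_) (^-distribˡ-+-* k k k) ⟩
    q ^ f * (k ^ k * k ^ k)              ≡⟨ *-assoc (q ^ f) _ _ ⟨
    q ^ f * k ^ k * k ^ k                ∎)
    where
    lemma : ∀ a b d → a * b * d ≡ a * d * b
    lemma = solve-∀
    lemma′ : ∀ a b d → a * b * d ≡ b * (a * d)
    lemma′ = solve-∀

  -- The count of `V` contributes 8^v. Bounding `v` by 8k rather than 6k contributes 8^f, and v + f
  -- = 6k merges both into the power of 8 in `c ^ k`.
  v^f-bound : 16 ^ k * m ^ k * 8 ^ v * v ^ f ≤ q ^ f * k ^ k
  v^f-bound = begin
    16 ^ k * m ^ k * 8 ^ v * v ^ f              ≤⟨ *-monoʳ-≤ (16 ^ k * m ^ k * 8 ^ v) (^-monoˡ-≤ f v≤8k) ⟩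
    16 ^ k * m ^ k * 8 ^ v * (8 * k) ^ f        ≡⟨ cong (16 ^ k * m ^ k * 8 ^ v *_) (^-distribʳ-* f 8 k) ⟩
    16 ^ k * m ^ k * 8 ^ v * (8 ^ f * k ^ f)    ≡⟨ lemma (16 ^ k) (m ^ k) (8 ^ v) (8 ^ f) (k ^ f) ⟩
    16 ^ k * (8 ^ v * 8 ^ f) * m ^ k * k ^ f    ≡⟨ cong (λ x → 16 ^ k * x * m ^ k * k ^ f) (^-distribˡ-+-* 8 v f) ⟨
    16 ^ k * 8 ^ (v + f) * m ^ k * k ^ f        ≡⟨ cong (λ x → 16 ^ k * 8 ^ x * m ^ k * k ^ f) v+f≡6k ⟩
    16 ^ k * 8 ^ (6 * k) * m ^ k * k ^ f        ≡⟨ cong (λ x → x * m ^ k * k ^ f) (c^k≡ k) ⟨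
    c ^ k * m ^ k * k ^ f                       ≤⟨ mk^f-bound ⟩
    q ^ f * k ^ k                               ∎
    where
    lemma : ∀ a b d g h → a * b * d * (g * h) ≡ a * (d * g) * b * h
    lemma = solve-∀

  [x^6]^k : ∀ x → (x ^ 6) ^ k ≡ x ^ v * x ^ f
  [x^6]^k x = trans (^-*-assoc x 6 k) (trans (cong (x ^_) (sym v+f≡6k)) (^-distribˡ-+-* x v f))

  -- Multiplying by k^k v^v lets `count≤-bound` absorb both counts. The 8 from choosing `R` and the
  -- spare factor 2 make up the 16 in `c`; the spare factor makes the failures summable over k.
  few-violations : 2 ^ k * (count≤ m k * count≤ q v * (v ^ 6) ^ k) ≤ (q ^ 6) ^ k
  few-violations = *-cancelʳ-≤ _ _ (k ^ k * v ^ v) {{m*n≢0 (k ^ k) (v ^ v) {{m^n≢0 k k}} {{m^n≢0 v v {{v≢0}}}}}} (begin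
    2 ^ k * (count≤ m k * count≤ q v * (v ^ 6) ^ k) * (k ^ k * v ^ v)
      ≡⟨ lemma₁ (2 ^ k) (count≤ m k) (count≤ q v) ((v ^ 6) ^ k) (k ^ k) (v ^ v) ⟩
    2 ^ k * (count≤ m k * k ^ k) * (count≤ q v * v ^ v) * (v ^ 6) ^ k
      ≤⟨ *-monoˡ-≤ ((v ^ 6) ^ k) (*-mono-≤ (*-monoʳ-≤ (2 ^ k) (count≤-bound k≤m)) (count≤-bound v≤q)) ⟩
    2 ^ k * (8 * m) ^ k * (8 * q) ^ v * (v ^ 6) ^ k
      ≡⟨ cong₂ _*_ (cong₂ _*_ (trans (sym (^-distribʳ-* k 2 (8 * m)))
           (trans (cong (_^ k) (lemma₂ m)) (^-distribʳ-* k 16 m))) (^-distribʳ-* v 8 q)) ([x^6]^k v) ⟩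
    16 ^ k * m ^ k * (8 ^ v * q ^ v) * (v ^ v * v ^ f)
      ≡⟨ lemma₃ (16 ^ k * m ^ k) (8 ^ v) (q ^ v) (v ^ v) (v ^ f) ⟩
    16 ^ k * m ^ k * 8 ^ v * v ^ f * (q ^ v * v ^ v)
      ≤⟨ *-monoˡ-≤ (q ^ v * v ^ v) v^f-bound ⟩
    q ^ f * k ^ k * (q ^ v * v ^ v)
      ≡⟨ lemma₄ (q ^ f) (k ^ k) (q ^ v) (v ^ v) ⟩
    q ^ v * q ^ f * (k ^ k * v ^ v)
      ≡⟨ cong (_* (k ^ k * v ^ v)) ([x^6]^k q) ⟨
    (q ^ 6) ^ k * (k ^ k * v ^ v) ∎)
    where
    v≢0 : NonZero v
    v≢0 = >-nonZero (≤-trans (>-nonZero⁻¹ k) (≤-trans (m≤m+n k _) (m≤m+n (4 * k) e)))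
    lemma₁ : ∀ a b d g h i → a * (b * d * g) * (h * i) ≡ a * (b * h) * (d * i) * g
    lemma₁ = solve-∀
    lemma₂ : ∀ m → 2 * (8 * m) ≡ 16 * m
    lemma₂ = solve-∀
    lemma₃ : ∀ a b d g h → a * (b * d) * (g * h) ≡ a * b * h * (d * g)
    lemma₃ = solve-∀
    lemma₄ : ∀ a b d g → a * b * (d * g) ≡ d * a * (b * g)
    lemma₄ = solve-∀

-- The union bound over all sizes

total : (ℕ → ℕ) → ℕ → ℕ
total f zero    = 0
total f (suc j) = f (suc j) + total f j

-- The geometric sum 1/2 + ... + 1/2^K = 1 - 1/2^K, cleared of denominators.
total-geometric : ∀ f Q K → (∀ k → 1 ≤ k → k ≤ K → 2 ^ k * f k ≤ Q) → 2 ^ K * total f K + Q ≤ 2 ^ K * Q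
total-geometric f Q zero    _  = ≤-reflexive (sym (*-identityˡ Q))
total-geometric f Q (suc K) bd = begin
  2 * 2 ^ K * (f (suc K) + total f K) + Q                    ≡⟨ lemma₁ (2 ^ K) (f (suc K)) (total f K) Q ⟩
  2 * 2 ^ K * f (suc K) + 2 * (2 ^ K * total f K) + Q        ≤⟨ +-monoˡ-≤ Q (+-monoˡ-≤ _ (bd (suc K) (s≤s z≤n) ≤-refl)) ⟩
  Q + 2 * (2 ^ K * total f K) + Q                            ≡⟨ lemma₂ Q (2 ^ K * total f K) ⟩
  2 * (2 ^ K * total f K + Q)                                ≤⟨ *-monoʳ-≤ 2 (total-geometric f Q K (λ k 1≤k k≤K → bd k 1≤k (m≤n⇒m≤1+n k≤K))) ⟩
  2 * (2 ^ K * Q)                                            ≡⟨ *-assoc 2 (2 ^ K) Q ⟨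
  2 * 2 ^ K * Q                                              ∎
  where
  open ≤-Reasoning
  lemma₁ : ∀ p a t r → 2 * p * (a + t) + r ≡ 2 * p * a + 2 * (p * t) + r
  lemma₁ = solve-∀
  lemma₂ : ∀ r t → r + 2 * t + r ≡ 2 * (t + r)
  lemma₂ = solve-∀

total<Q : ∀ f Q K → 1 ≤ Q → (∀ k → 1 ≤ k → k ≤ K → 2 ^ k * f k ≤ Q) → total f K < Q
total<Q f Q K 1≤Q bd = *-cancelˡ-< (2 ^ K) _ _ (begin-strict
  2 ^ K * total f K        <⟨ m<m+n _ 1≤Q ⟩
  2 ^ K * total f K + Q    ≤⟨ total-geometric f Q K bd ⟩
  2 ^ K * Q                ∎)
  where open ≤-Reasoning

∑-total : (xs : List A) (f : ℕ → A → ℕ) → ∀ K → ∑ xs (λ x → total (λ k → f k x) K) ≡ total (λ k → ∑ xs (f k)) K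
∑-total xs f zero    = ∑-0 xs
∑-total xs f (suc K) = trans (∑-+ xs (f (suc K)) _) (cong (∑ xs (f (suc K)) +_) (∑-total xs f K))

total≡0 : ∀ f K → total f K ≡ 0 → ∀ k → 1 ≤ k → k ≤ K → f k ≡ 0
total≡0 f zero    eq k 1≤k k≤0 = contradiction (≤-trans 1≤k k≤0) λ ()
total≡0 f (suc K) eq k 1≤k k≤K with m≤n⇒m<n∨m≡n k≤K
... | inj₁ k<K  = total≡0 f K (m+n≡0⇒n≡0 (f (suc K)) eq) k 1≤k (s≤s⁻¹ k<K)
... | inj₂ refl = m+n≡0⇒m≡0 (f (suc K)) eq

union-bound : ∀ m q K (v : ℕ → ℕ) .{{_ : NonZero q}} →
  (∀ k → 1 ≤ k → k ≤ K → 2 ^ k * (count≤ m k * count≤ q (v k) * (v k ^ 6) ^ k) ≤ (q ^ 6) ^ k) →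
  ∃ λ (g : Graph m q) → ∀ R → 1 ≤ ∣ R ∣ → ∣ R ∣ ≤ K → v ∣ R ∣ < ∣ nbr (cells ∘ lookup g) R ∣
union-bound m q K v few = g , λ R 1≤R R≤K →
    no-violation m q (∣ R ∣) (v ∣ R ∣) g (total≡0 _ K g-none (∣ R ∣) 1≤R R≤K) R refl
  where
  open ≤-Reasoning
  Q = q ^ 6
  G = graphs m q
  T : ℕ → ℕ
  T k = ∑ G (violations m q k (v k))
  bound : ∀ k → 1 ≤ k → k ≤ K → 2 ^ k * T k ≤ Q ^ m
  bound k 1≤k k≤K = *-cancelʳ-≤ _ _ (Q ^ k) {{m^n≢0 Q k {{m^n≢0 q 6}}}} (begin
    2 ^ k * T k * Q ^ k                    ≡⟨ *-assoc (2 ^ k) (T k) _ ⟩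
    2 ^ k * (T k * Q ^ k)                  ≤⟨ *-monoʳ-≤ (2 ^ k) (∑-violations m q k (v k)) ⟩
    2 ^ k * (N * Q ^ m)                    ≡⟨ *-assoc (2 ^ k) N _ ⟨
    2 ^ k * N * Q ^ m                      ≤⟨ *-monoˡ-≤ (Q ^ m) (few k 1≤k k≤K) ⟩
    Q ^ k * Q ^ m                          ≡⟨ *-comm (Q ^ k) _ ⟩
    Q ^ m * Q ^ k                          ∎)
    where N = count≤ m k * count≤ q (v k) * (v k ^ 6) ^ k
  found : ∃ λ g → total (λ k → violations m q k (v k) g) K ≡ 0
  found = ∃-zero G _ (begin-strict
    ∑ G (λ g → total (λ k → violations m q k (v k) g) K)  ≡⟨ ∑-total G (λ k → violations m q k (v k)) K ⟩
    total T K                                             <⟨ total<Q T (Q ^ m) K (m^n>0 Q {{m^n≢0 q 6}} m) bound ⟩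
    Q ^ m                                                 ≡⟨ ∣graphs∣ m q ⟨
    ∑ G (const 1)                                         ∎)
  g = proj₁ found
  g-none = proj₂ found

*-cancel-square-≤ : ∀ {x y} → x * x ≤ y * y → x ≤ y
*-cancel-square-≤ xx≤yy = ≮⇒≥ λ y<x → contradiction (≤-trans (*-mono-< y<x y<x) xx≤yy) (<-irrefl refl)

-- The first hypothesis controls all sizes up to `k₀` at once, because m k grows with k. The second
-- says that at size `k₀` the slack costs at most 2^k₀, and the third leaves a nonnegative exponent
-- 2k₀ - e.
expander : ∀ m n k₀ q .{{_ : NonZero m}} .{{_ : NonZero n}} → 2 * (c * (m * k₀)) ≤ q * q →
  q ^ (2 * n + 1) ≤ 2 ^ k₀ * k₀ ^ (2 * n + 1) → 2 * n + 1 ≤ k₀ + k₀ →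
  ∃ λ (g : Graph m q) → Expands n k₀ (cells ∘ lookup g)
expander m n k₀ q cmk₀≤q² q^e≤ e≤2k₀ = g , record
  { small = λ R R≤k₀ → case 1 ≤? ∣ R ∣ of λ
      { (yes 1≤R) → ≤-trans (m≤m+n (4 * ∣ R ∣) _) (<⇒≤ (expands R 1≤R (⊓-glb R≤k₀ (∣p∣≤n R))))
      ; (no  R<1) → ≤-trans (≤-reflexive (trans (cong (4 *_) (n<1⇒n≡0 (≰⇒> R<1))) (*-zeroʳ 4))) z≤n
      }
  ; large = λ R R≡k₀ → begin
      4 * k₀ + 2 * n + 2                ≡⟨ lemma (4 * k₀) (2 * n) ⟩
      suc (4 * k₀ + (2 * n + 1))        ≡⟨ cong (λ k → suc (4 * k + (2 * n + 1))) R≡k₀ ⟨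
      suc (4 * ∣ R ∣ + (2 * n + 1))     ≡⟨ cong (λ e → suc (4 * ∣ R ∣ + e)) (slack-k₀ R≡k₀) ⟨
      suc (v ∣ R ∣)                     ≤⟨ expands R (subst (1 ≤_) (sym R≡k₀) k₀≥1)
                                             (⊓-glb (≤-reflexive R≡k₀) (∣p∣≤n R)) ⟩
      ∣ nbr (cells ∘ lookup g) R ∣      ∎
  }
  where
  open ≤-Reasoning
  lemma : ∀ a b → a + b + 2 ≡ suc (a + (b + 1))
  lemma = solve-∀
  k₀≥1 : 1 ≤ k₀
  k₀≥1 = n≢0⇒n>0 λ { refl → contradiction (≤-trans (m≤n+m 1 (2 * n)) e≤2k₀) λ () }
  -- Only the sets of size k₀ are required to expand by more than 4: for them q ^ (2n + 1) is absorbed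
  -- by 2 ^ k₀, while for small k the union bound leaves no room.
  slack v : ℕ → ℕ
  slack k = if does (k ≟ k₀) then 2 * n + 1 else 0
  v k = 4 * k + slack k
  slack-k₀ : ∀ {k} → k ≡ k₀ → slack k ≡ 2 * n + 1
  slack-k₀ {k} eq = cong (if_then 2 * n + 1 else 0) (dec-true (k ≟ k₀) eq)
  36mk≤q² : ∀ k → k ≤ k₀ → 36 * (m * k) ≤ q * q
  36mk≤q² k k≤k₀ = begin
    36 * (m * k)           ≤⟨ *-mono-≤ 36≤c (*-monoʳ-≤ m k≤k₀) ⟩
    c * (m * k₀)           ≤⟨ m≤m+n _ _ ⟩
    2 * (c * (m * k₀))     ≤⟨ cmk₀≤q² ⟩
    q * q                  ∎
  few-with : ∀ k e → 1 ≤ k → k ≤ k₀ → k ≤ m → e ≤ k + k → q ^ e ≤ 2 ^ k * k ^ e →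
    2 ^ k * (count≤ m k * count≤ q (4 * k + e) * ((4 * k + e) ^ 6) ^ k) ≤ (q ^ 6) ^ k
  few-with k e 1≤k k≤k₀ k≤m e≤2k q^e≤ = Failure.few-violations m q k e (k + k ∸ e)
    {{>-nonZero (≤-trans 1≤k k≤m)}} {{>-nonZero q≥1}} {{>-nonZero 1≤k}}
    (m+[n∸m]≡n e≤2k) k≤m (≤-trans v≤6k 6k≤q) q^e≤
    (≤-trans (*-monoʳ-≤ 2 (*-monoʳ-≤ c (*-monoʳ-≤ m k≤k₀))) cmk₀≤q²)
    where
    lemma₁ : ∀ k → 4 * k + (k + k) ≡ 6 * k
    lemma₁ = solve-∀
    lemma₂ : ∀ k → 6 * k * (6 * k) ≡ 36 * (k * k)
    lemma₂ = solve-∀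
    v≤6k : 4 * k + e ≤ 6 * k
    v≤6k = ≤-trans (+-monoʳ-≤ (4 * k) e≤2k) (≤-reflexive (lemma₁ k))
    6k≤q : 6 * k ≤ q
    6k≤q = *-cancel-square-≤ (begin
      6 * k * (6 * k)     ≡⟨ lemma₂ k ⟩
      36 * (k * k)        ≤⟨ *-monoʳ-≤ 36 (*-monoˡ-≤ k k≤m) ⟩
      36 * (m * k)        ≤⟨ 36mk≤q² k k≤k₀ ⟩
      q * q               ∎)
    q≥1 : 1 ≤ q
    q≥1 = ≤-trans (≤-trans 1≤k (m≤m+n k _)) 6k≤q
  few : ∀ k → 1 ≤ k → k ≤ k₀ ⊓ m →
    2 ^ k * (count≤ m k * count≤ q (v k) * (v k ^ 6) ^ k) ≤ (q ^ 6) ^ k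
  few k 1≤k k≤ = few-with k (slack k) 1≤k (≤-trans k≤ (m⊓n≤m k₀ m)) (≤-trans k≤ (m⊓n≤n k₀ m))
    (proj₁ (slack-fits (k ≟ k₀))) (proj₂ (slack-fits (k ≟ k₀)))
    where
    slack-fits : Dec (k ≡ k₀) → slack k ≤ k + k × q ^ slack k ≤ 2 ^ k * k ^ slack k
    slack-fits (yes k≡k₀) =
      subst₂ (λ k e → e ≤ k + k × q ^ e ≤ 2 ^ k * k ^ e) (sym k≡k₀) (sym (slack-k₀ k≡k₀)) (e≤2k₀ , q^e≤)
    slack-fits (no k≢k₀) =
      subst (λ e → e ≤ k + k × q ^ e ≤ 2 ^ k * k ^ e)
        (sym (cong (if_then 2 * n + 1 else 0) (dec-false (k ≟ k₀) k≢k₀)))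
        (z≤n , *-mono-≤ {1} {2 ^ k} (m^n>0 2 k) (≤-refl {1}))
  q≢0 : NonZero q
  q≢0 = ≢-nonZero λ { refl → contradiction (≤-trans (36mk≤ k₀≥1) (36mk≤q² k₀ ≤-refl)) λ () }
    where
    36mk≤ : 1 ≤ k₀ → 1 ≤ 36 * (m * k₀)
    36mk≤ 1≤k₀ = *-mono-≤ {1} {36} (s≤s z≤n) (*-mono-≤ (>-nonZero⁻¹ m) 1≤k₀)
  -- No set has more than `m` elements; stopping at `k₀ ⊓ m` provides the k ≤ m that `count≤-bound`
  -- requires.
  found : ∃ λ (g : Graph m q) → ∀ R → 1 ≤ ∣ R ∣ → ∣ R ∣ ≤ k₀ ⊓ m → v ∣ R ∣ < ∣ nbr (cells ∘ lookup g) R ∣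
  found = union-bound m q (k₀ ⊓ m) v {{q≢0}} few
  g = proj₁ found
  expands = proj₂ found

-- Choice of the parameters

integer-sqrt : ∀ x → 1 ≤ x → ∃ λ r → x ≤ r * r × r * r ≤ 4 * x
integer-sqrt (suc zero)        _ = 1 , s≤s z≤n , s≤s z≤n
integer-sqrt (suc x@(suc _)) _ with integer-sqrt x (s≤s z≤n)
... | r , x≤ , ≤4x with suc x ≤? r * r
...   | yes 1+x≤ = r , 1+x≤ , ≤-trans ≤4x (*-monoʳ-≤ 4 (n≤1+n x))
...   | no  1+x≰ = suc r , (begin
    suc x                    ≤⟨ s≤s x≤ ⟩
    suc (r * r)              ≤⟨ s≤s (≤-trans (*-monoʳ-≤ r (n≤1+n r)) (m≤n+m _ r)) ⟩
    suc r * suc r            ∎) , (begin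
    suc r * suc r            ≤⟨ *-mono-≤ 1+r≤2r 1+r≤2r ⟩
    2 * r * (2 * r)          ≡⟨ lemma r ⟩
    4 * (r * r)              ≤⟨ *-monoʳ-≤ 4 (<⇒≤ (≰⇒> 1+x≰)) ⟩
    4 * suc x                ∎)
  where
  open ≤-Reasoning
  lemma : ∀ r → 2 * r * (2 * r) ≡ 4 * (r * r)
  lemma = solve-∀
  1≤r : ∀ r → x ≤ r * r → 1 ≤ r
  1≤r (suc r) _ = s≤s z≤n
  1+r≤2r : suc r ≤ 2 * r
  1+r≤2r = +-mono-≤ (1≤r r x≤) (≤-reflexive (sym (+-identityʳ r)))

-- An integer `L` between lg(m/n) and lg(2m/n). The lower estimate makes `k₀` large enough for the
-- expander, the upper one keeps the memory within the claimed bound.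
integer-log : ∀ m n → 1 ≤ n → n ≤ m → ∃ λ L → 1 ≤ L × m ≤ n * 2 ^ L × n * 2 ^ L ≤ 2 * m
integer-log m n 1≤n n≤m = go m 1 (s≤s z≤n) (m≤m+n m _)
  (≤-trans (≤-reflexive (*-comm n 2)) (*-monoʳ-≤ 2 n≤m))
  where
  open ≤-Reasoning
  n<2^n : ∀ n → n < 2 ^ n
  n<2^n zero    = s≤s z≤n
  n<2^n (suc n) = begin
    suc (suc n)       ≤⟨ +-mono-≤ (m^n>0 2 n) (n<2^n n) ⟩
    2 ^ n + 2 ^ n     ≡⟨ cong (2 ^ n +_) (+-identityʳ (2 ^ n)) ⟨
    2 ^ suc n         ∎
  go : ∀ fuel L → 1 ≤ L → m ≤ fuel + L → n * 2 ^ L ≤ 2 * m → ∃ λ L → 1 ≤ L × m ≤ n * 2 ^ L × n * 2 ^ L ≤ 2 * m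
  go fuel L 1≤L m≤ n2^L≤ with m ≤? n * 2 ^ L
  ... | yes m≤n2^L = L , 1≤L , m≤n2^L , n2^L≤
  go zero L 1≤L m≤L n2^L≤ | no m≰ = contradiction (begin
    m             ≤⟨ m≤L ⟩
    L             ≤⟨ <⇒≤ (n<2^n L) ⟩
    2 ^ L         ≡⟨ *-identityˡ _ ⟨
    1 * 2 ^ L     ≤⟨ *-monoˡ-≤ (2 ^ L) 1≤n ⟩
    n * 2 ^ L     ∎) m≰
  go (suc fuel) L 1≤L m≤ n2^L≤ | no m≰ = go fuel (suc L) (s≤s z≤n)
    (≤-trans m≤ (≤-reflexive (sym (+-suc fuel L)))) (begin
    n * (2 * 2 ^ L)     ≡⟨ lemma n (2 ^ L) ⟩
    2 * (n * 2 ^ L)     ≤⟨ *-monoʳ-≤ 2 (<⇒≤ (≰⇒> m≰)) ⟩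
    2 * m               ∎)
    where
    lemma : ∀ n p → n * (2 * p) ≡ 2 * (n * p)
    lemma = solve-∀

-- 36 is the square of the six tables, 4 the loss in `integer-sqrt`, `2 * c` the requirement on q²,
-- and `2 * suc h` the factor of n L in `k₀`.
K : ℕ
K = 36 * (4 * (2 * (c * (2 * suc h))))

-- Taking lg turns the inequality into s² ≤ K m n lg(2m/n), so C is the square root of `K`; integer
-- powers avoid real logarithms. The minimum over all schemes is at most this `s`.
theorem3 : Σ ℕ λ K → Σ ℕ λ M → (m n : ℕ) → M ≤ m → 0 < n → n ≤ m →
    Σ ℕ λ s → Scheme m n s 3 ×
    (n ^ (K * m * n)) * (2 ^ (s * s)) ≤ (2 * m) ^ (K * m * n)
theorem3 = K , 0 , λ m n _ → sized m n
  where
  open ≤-Reasoning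
  sized : (m n : ℕ) → 0 < n → n ≤ m →
    Σ ℕ λ s → Scheme m n s 3 × (n ^ (K * m * n)) * (2 ^ (s * s)) ≤ (2 * m) ^ (K * m * n)
  sized m n 0<n n≤m = 6 * b , scheme (lookup (proj₁ graph)) (proj₂ graph) n≤k₀ , small-memory
    where
    log = integer-log m n 0<n n≤m
    L = proj₁ log
    1≤L = proj₁ (proj₂ log)
    m≤n2^L = proj₁ (proj₂ (proj₂ log))
    n2^L≤2m = proj₂ (proj₂ (proj₂ log))
    0<m : 0 < m
    0<m = ≤-trans 0<n n≤m
    -- `e` is at most 3n and `h + L` at most `suc h * L`, so this `k₀` makes `(h + L) * e` at most
    -- `k₀ + k₀`.
    k₀ = 2 * suc h * (n * L)
    e = 2 * n + 1
    n≤nL : n ≤ n * L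
    n≤nL = ≤-trans (≤-reflexive (sym (*-identityʳ n))) (*-monoʳ-≤ n 1≤L)
    2n≤k₀ : 2 * n ≤ k₀
    2n≤k₀ = *-mono-≤ (*-monoʳ-≤ 2 (s≤s (z≤n {h}))) n≤nL
    n≤k₀ : n ≤ k₀
    n≤k₀ = ≤-trans (m≤m+n n _) 2n≤k₀
    e≤3n : e ≤ 3 * n
    e≤3n = ≤-trans (+-monoʳ-≤ (2 * n) 0<n) (≤-reflexive (lemma n))
      where
      lemma : ∀ n → 2 * n + n ≡ 3 * n
      lemma = solve-∀
    e≤2k₀ : e ≤ k₀ + k₀
    e≤2k₀ = begin
      e            ≤⟨ e≤3n ⟩
      3 * n        ≡⟨ lemma n ⟩
      n + 2 * n    ≤⟨ +-mono-≤ n≤k₀ 2n≤k₀ ⟩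
      k₀ + k₀      ∎
      where
      lemma : ∀ n → 3 * n ≡ n + 2 * n
      lemma = solve-∀
    cmk₀≥1 : 1 ≤ 2 * (c * (m * k₀))
    cmk₀≥1 = *-mono-≤ {1} {2} (s≤s z≤n) (*-mono-≤ {1} {c} (≤-trans (s≤s z≤n) 36≤c)
      (*-mono-≤ 0<m (≤-trans 0<n n≤k₀)))
    root = integer-sqrt (2 * (c * (m * k₀))) cmk₀≥1
    b = proj₁ root
    q²≥ = proj₁ (proj₂ root)
    q²≤ = proj₂ (proj₂ root)
    exponent : (h + L) * e ≤ k₀ + k₀
    exponent = begin
      (h + L) * e                       ≤⟨ *-mono-≤ h+L≤ e≤3n ⟩
      suc h * L * (3 * n)               ≤⟨ *-monoʳ-≤ (suc h * L) (*-monoˡ-≤ n (n≤1+n 3)) ⟩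
      suc h * L * (4 * n)               ≡⟨ lemma (suc h) L n ⟩
      k₀ + k₀                           ∎
      where
      h+L≤ : h + L ≤ suc h * L
      h+L≤ = ≤-trans (≤-reflexive (+-comm h L)) (+-monoʳ-≤ L
        (≤-trans (≤-reflexive (sym (*-identityʳ h))) (*-monoʳ-≤ h 1≤L)))
      lemma : ∀ s l n → s * l * (4 * n) ≡ 2 * s * (n * l) + 2 * s * (n * l)
      lemma = solve-∀
    -- With `b` as q, this is (q/k₀)² ≤ 2^(h + L), since m ≤ k₀ 2^L. Its e-th power is at most 4^k₀
    -- by `exponent`.
    q²≤′ : b * b ≤ 2 ^ (h + L) * (k₀ * k₀)
    q²≤′ = begin
      b * b                                ≤⟨ q²≤ ⟩
      4 * (2 * (c * (m * k₀)))             ≡⟨ lemma c (m * k₀) ⟩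
      4 * (2 * c) * (m * k₀)               ≤⟨ *-mono-≤ 8c≤2^h (*-monoˡ-≤ k₀ (≤-trans m≤n2^L (*-monoˡ-≤ (2 ^ L) n≤k₀))) ⟩
      2 ^ h * (k₀ * 2 ^ L * k₀)            ≡⟨ lemma′ (2 ^ h) k₀ (2 ^ L) ⟩
      2 ^ h * 2 ^ L * (k₀ * k₀)            ≡⟨ cong (_* (k₀ * k₀)) (^-distribˡ-+-* 2 h L) ⟨
      2 ^ (h + L) * (k₀ * k₀)              ∎
      where
      lemma : ∀ c x → 4 * (2 * (c * x)) ≡ 4 * (2 * c) * x
      lemma = solve-∀
      lemma′ : ∀ a k b → a * (k * b * k) ≡ a * b * (k * k)
      lemma′ = solve-∀
    q^e≤ : b ^ e ≤ 2 ^ k₀ * k₀ ^ e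
    q^e≤ = *-cancel-square-≤ (begin
      b ^ e * b ^ e                                   ≡⟨ ^-distribʳ-* e b b ⟨
      (b * b) ^ e                                     ≤⟨ ^-monoˡ-≤ e q²≤′ ⟩
      (2 ^ (h + L) * (k₀ * k₀)) ^ e                   ≡⟨ ^-distribʳ-* e _ _ ⟩
      (2 ^ (h + L)) ^ e * (k₀ * k₀) ^ e               ≡⟨ cong₂ _*_ (^-*-assoc 2 (h + L) e) (^-distribʳ-* e k₀ k₀) ⟩
      2 ^ ((h + L) * e) * (k₀ ^ e * k₀ ^ e)           ≤⟨ *-monoˡ-≤ _ (^-monoʳ-≤ 2 exponent) ⟩
      2 ^ (k₀ + k₀) * (k₀ ^ e * k₀ ^ e)               ≡⟨ cong (_* (k₀ ^ e * k₀ ^ e)) (^-distribˡ-+-* 2 k₀ k₀) ⟩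
      2 ^ k₀ * 2 ^ k₀ * (k₀ ^ e * k₀ ^ e)             ≡⟨ lemma (2 ^ k₀) (k₀ ^ e) ⟩
      2 ^ k₀ * k₀ ^ e * (2 ^ k₀ * k₀ ^ e)             ∎)
      where
      lemma : ∀ a b → a * a * (b * b) ≡ a * b * (a * b)
      lemma = solve-∀
    graph = expander m n k₀ b {{>-nonZero 0<m}} {{>-nonZero 0<n}} q²≥ q^e≤ e≤2k₀
    s²≤ : 6 * b * (6 * b) ≤ L * (K * m * n)
    s²≤ = begin
      6 * b * (6 * b)                          ≡⟨ lemma b ⟩
      36 * (b * b)                             ≤⟨ *-monoʳ-≤ 36 q²≤ ⟩
      36 * (4 * (2 * (c * (m * k₀))))          ≡⟨ lemma′ c m (suc h) n L ⟩
      L * (K * m * n)                          ∎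
      where
      lemma : ∀ b → 6 * b * (6 * b) ≡ 36 * (b * b)
      lemma = solve-∀
      lemma′ : ∀ c m s n l → 36 * (4 * (2 * (c * (m * (2 * s * (n * l)))))) ≡
        l * (36 * (4 * (2 * (c * (2 * s)))) * m * n)
      lemma′ = solve-∀
    small-memory : n ^ (K * m * n) * 2 ^ (6 * b * (6 * b)) ≤ (2 * m) ^ (K * m * n)
    small-memory = begin
      n ^ P * 2 ^ (6 * b * (6 * b))      ≤⟨ *-monoʳ-≤ (n ^ P) (^-monoʳ-≤ 2 s²≤) ⟩
      n ^ P * 2 ^ (L * P)                ≡⟨ cong (n ^ P *_) (^-*-assoc 2 L P) ⟨
      n ^ P * (2 ^ L) ^ P                ≡⟨ ^-distribʳ-* P n (2 ^ L) ⟨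
      (n * 2 ^ L) ^ P                    ≤⟨ ^-monoˡ-≤ P n2^L≤2m ⟩
      (2 * m) ^ P                        ∎
      where P = K * m * n
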